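{- There is an adaptive distribution tester for the property of being the uniform distribution over $[n]$ (that is, for the property $\{U_n\}$, where $U_n(i)=1/n$ for all $i\in[n]$) whose conditional sample complexity is $\mathrm{poly}(\epsilon^{ -1},\log(\delta^{ -1}))$, independently of $n$. That is, there is a polynomial $p$ such that for all $\epsilon,\delta\in(0,1)$ and all $n$ the tester makes at most $p(\epsilon^{ -1},\log(\delta^{ -1}))$ conditional samples.
   Context: $[n]=\{1,\ldots,n\}$. A conditional sampling oracle for a distribution $\mu$ over $[n]$ takes a nonempty set $A\subseteq[n]$ and returns $j\in A$ with probability $\mu(j)/\mu(A)$ if $\mu(A)>0$, and a uniformly random member of $A$ if $\mu(A)=0$, independently of all previous samples. The variation distance is $d(\mu,\mu')=\frac12\sum_{i=1}^n|\mu(i)-\mu'(i)|$. A property $\mathcal P$ is a set of distributions over $[n]$; $\mu$ is $\epsilon$-far from $\mathcal P$ if $d(\mu,\mu')\ge\epsilon$ for every $\mu'\in\mathcal P$. An adaptive distribution tester for $\mathcal P$ with conditional sample complexity $t(\epsilon,\delta,n)$ is a randomized algorithm that receives $\epsilon,\delta>0$, $n\in\mathbb N$ and a conditional sampling oracle for an unknown distribution $\mu$ over $[n]$. In phase $i=1,\ldots,t(\epsilon,\delta,n)$ it generates a set $A_i\subseteq[n]$ based on the previously received samples $j_1,\ldots,j_{i-1}$ and its internal coin tosses, and receives a sample $j_i$ from the oracle on $A_i$. At the end it accepts or rejects based on $j_1,\ldots,j_t$ and its coin tosses. If $\mu\in\mathcal P$ it must accept with probability at least $1-\delta$; if $\mu$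 is $\epsilon$-far from $\mathcal P$ it must reject with probability at least $1-\delta$. $f=\mathrm{poly}(g_1,\ldots,g_k)$ means that there is a polynomial $p$ with $f\le p(g_1,\ldots,g_k)$ for all values of the arguments in their domains. -}

module Defs where

open import Algebra.Bundles using (CommutativeRing; Semiring)
open import Algebra.Structures using (IsCommutativeRing)
import Algebra.Definitions.RawSemiring
import Algebra.Properties.Monoid.Sum
import Algebra.Properties.Semiring.Exp
import Algebra.Properties.Semiring.Mult
open import Data.Bool using (Bool; true; false; if_then_else_)
open import Data.Empty using (⊥)
open import Data.Fin using (Fin)
open import Data.Fin.Subset using (Subset; Nonempty; ∣_∣)
open import Data.List using (List; foldr)
open import Data.Nat as ℕ using (ℕ; zero; suc; NonZero)
import Data.Nat.Properties as ℕ
open import Data.Product using (∃; ∃-syntax; _×_; _,_; proj₁; proj₂)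
open import Data.Sum using (inj₁; inj₂)
open import Data.Vec using (lookup)
open import Level using (0ℓ)
open import Relation.Binary using (Rel; IsStrictTotalOrder; tri<; tri≈; tri>)
import Relation.Binary.Construct.StrictToNonStrict as StrictToNonStrict
open import Relation.Binary.PropositionalEquality
open import Relation.Nullary using (yes; no; does; contradiction)

-- s is an upper bound of P, and nothing below s is one.  The second clause is
-- phrased positively, which classically is the same thing.

record IsSupremum {A : Set} (_<_ : Rel A 0ℓ) (P : A → Set) (s : A) : Set where
  field
    upper : ∀ {x} → P x → StrictToNonStrict._≤_ _≡_ _<_ x s
    least : ∀ {y} → y < s → ∃[ x ] P x × y < x

-- The real numbers, axiomatised classically as a Dedekind-complete ordered
-- field.

record RealNumbers : Set₁ where
  infix  4 _<_ _≤_
  infixl 6 _+_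
  infixl 7 _*_ _/_
  infix  8 -_
  infix  9 _⁻¹

  field
    ℝ     : Set
    _+_   : ℝ → ℝ → ℝ
    _*_   : ℝ → ℝ → ℝ
    -_    : ℝ → ℝ
    0ℝ 1ℝ : ℝ
    _⁻¹   : ℝ → ℝ
    _<_   : Rel ℝ 0ℓ

  _≤_ : Rel ℝ 0ℓ
  _≤_ = StrictToNonStrict._≤_ _≡_ _<_

  field
    isCommutativeRing  : IsCommutativeRing _≡_ _+_ _*_ -_ 0ℝ 1ℝ
    -- 0ℝ ⁻¹ is left unspecified.
    *-inverseʳ         : ∀ {x} → x ≢ 0ℝ → x * x ⁻¹ ≡ 1ℝ
    isStrictTotalOrder : IsStrictTotalOrder _≡_ _<_
    0<1                : 0ℝ < 1ℝ
    +-monoˡ-<          : ∀ {x y} z → x < y → x + z < y + z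
    *-monoˡ-<          : ∀ {x y z} → 0ℝ < z → x < y → x * z < y * z
    completeness       : (P : ℝ → Set) → ∃ P → (∃[ b ] ∀ {x} → P x → x ≤ b) →
                         ∃ (IsSupremum _<_ P)

  commutativeRing : CommutativeRing 0ℓ 0ℓ
  commutativeRing = record { isCommutativeRing = isCommutativeRing }

  open CommutativeRing commutativeRing public
    using (_-_; semiring; +-monoid; +-comm; +-assoc;
           +-identityˡ; +-identityʳ; -‿inverseˡ; -‿inverseʳ; *-comm; *-assoc;
           *-identityˡ; *-identityʳ; distribˡ; distribʳ; zeroˡ; zeroʳ)

  open Algebra.Definitions.RawSemiring (Semiring.rawSemiring semiring) public
    using (_^_; sum) renaming (_×_ to _·_)

  open IsStrictTotalOrder isStrictTotalOrder public
    using (_<?_; compare) renaming (trans to <-trans; irrefl to <-irrefl)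

  _/_ : ℝ → ℝ → ℝ
  x / y = x * y ⁻¹

  fromℕ : ℕ → ℝ
  fromℕ n = n · 1ℝ

  abs : ℝ → ℝ
  abs x = if does (x <? 0ℝ) then - x else x

module RealProperties (R : RealNumbers) where
  open RealNumbers R
  open Algebra.Properties.Semiring.Exp semiring using (^-homo-*; ^-assocʳ)
  open Algebra.Properties.Semiring.Mult semiring using (×1-homo-*; ×-homo-+)

  <-≤-trans : ∀ {x y z} → x < y → y ≤ z → x < z
  <-≤-trans p (inj₁ q)    = <-trans p q
  <-≤-trans p (inj₂ refl) = p

  ≤-trans : ∀ {x y z} → x ≤ y → y ≤ z → x ≤ z
  ≤-trans (inj₁ p)    q = inj₁ (<-≤-trans p q)
  ≤-trans (inj₂ refl) q = q

  ≮⇒≥ : ∀ {x y} → (x < y → ⊥) → y ≤ x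
  ≮⇒≥ {x} {y} x≮y with compare x y
  ... | tri< p _ _ = contradiction p x≮y
  ... | tri≈ _ p _ = inj₂ (sym p)
  ... | tri> _ _ p = inj₁ p

  +-monoˡ-≤ : ∀ {x y} z → x ≤ y → x + z ≤ y + z
  +-monoˡ-≤ z (inj₁ p)    = inj₁ (+-monoˡ-< z p)
  +-monoˡ-≤ z (inj₂ refl) = inj₂ refl

  +-monoʳ-≤ : ∀ {x y} z → x ≤ y → z + x ≤ z + y
  +-monoʳ-≤ {x} {y} z p = subst₂ _≤_ (+-comm x z) (+-comm y z) (+-monoˡ-≤ z p)

  +-monoʳ-< : ∀ {x y} z → x < y → z + x < z + y
  +-monoʳ-< {x} {y} z p = subst₂ _<_ (+-comm x z) (+-comm y z) (+-monoˡ-< z p)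

  *-monoˡ-≤ : ∀ {x y z} → 0ℝ < z → x ≤ y → x * z ≤ y * z
  *-monoˡ-≤ 0<z (inj₁ p)    = inj₁ (*-monoˡ-< 0<z p)
  *-monoˡ-≤ 0<z (inj₂ refl) = inj₂ refl

  *-monoʳ-≤ : ∀ {x y z} → 0ℝ < z → x ≤ y → z * x ≤ z * y
  *-monoʳ-≤ {x} {y} {z} 0<z p =
    subst₂ _≤_ (*-comm x z) (*-comm y z) (*-monoˡ-≤ 0<z p)

  x-y+y : ∀ x y → x - y + y ≡ x
  x-y+y x y = trans (+-assoc x (- y) y)
                (trans (cong (x +_) (-‿inverseˡ y)) (+-identityʳ x))

  x+y-y : ∀ x y → x + y - y ≡ x
  x+y-y x y = trans (+-assoc x y (- y))
                (trans (cong (x +_) (-‿inverseʳ y)) (+-identityʳ x))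

  x<x+1 : ∀ x → x < x + 1ℝ
  x<x+1 x = subst (_< x + 1ℝ) (+-identityʳ x) (+-monoʳ-< x 0<1)

  x-1<x : ∀ x → x - 1ℝ < x
  x-1<x x = subst (x - 1ℝ <_) (x-y+y x 1ℝ) (x<x+1 (x - 1ℝ))

  *-pos : ∀ {x y} → 0ℝ < x → 0ℝ < y → 0ℝ < x * y
  *-pos {x} {y} p q = subst (_< x * y) (zeroˡ y) (*-monoˡ-< q p)

  0<⇒≢0 : ∀ {x} → 0ℝ < x → x ≢ 0ℝ
  0<⇒≢0 p refl = <-irrefl refl p

  ⁻¹-pos : ∀ {x} → 0ℝ < x → 0ℝ < x ⁻¹
  ⁻¹-pos {x} 0<x with compare 0ℝ (x ⁻¹)
  ... | tri< p _ _ = p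
  ... | tri≈ _ p _ = contradiction
          (subst (0ℝ <_) (trans (sym (*-inverseʳ (0<⇒≢0 0<x)))
                           (trans (cong (x *_) (sym p)) (zeroʳ x))) 0<1)
          (<-irrefl refl)
  ... | tri> _ _ p = contradiction
          (<-trans 0<1 (subst₂ _<_ (trans (*-comm (x ⁻¹) x) (*-inverseʳ (0<⇒≢0 0<x)))
                                   (zeroˡ x) (*-monoˡ-< 0<x p)))
          (<-irrefl refl)

  fromℕ-nonneg : ∀ n → 0ℝ ≤ fromℕ n
  fromℕ-nonneg zero    = inj₂ refl
  fromℕ-nonneg (suc n) = ≤-trans (fromℕ-nonneg n)
    (inj₁ (subst (fromℕ n <_) (+-comm (fromℕ n) 1ℝ) (x<x+1 (fromℕ n))))

  fromℕ-pos : ∀ n → .{{NonZero n}} → 0ℝ < fromℕ n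
  fromℕ-pos (suc n) =
    <-≤-trans 0<1 (subst (_≤ fromℕ (suc n)) (+-identityʳ 1ℝ) (+-monoʳ-≤ 1ℝ (fromℕ-nonneg n)))

  fromℕ-mono-≤ : ∀ {m n} → m ℕ.≤ n → fromℕ m ≤ fromℕ n
  fromℕ-mono-≤ {n = n} ℕ.z≤n = fromℕ-nonneg n
  fromℕ-mono-≤ (ℕ.s≤s p)     = +-monoʳ-≤ 1ℝ (fromℕ-mono-≤ p)

  archimedean : ∀ x → ∃[ n ] x < fromℕ n
  archimedean x with x <? 0ℝ
  ... | yes x<0 = 0 , x<0
  ... | no  x≮0 = suc n , x<1+n
    where
    P : ℝ → Set
    P z = ∃[ k ] z ≡ fromℕ k × fromℕ k ≤ x

    P-sup : ∃ (IsSupremum _<_ P)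
    P-sup = completeness P (0ℝ , 0 , refl , ≮⇒≥ x≮0) (x , λ { (_ , refl , p) → p })

    s = proj₁ P-sup
    open IsSupremum (proj₂ P-sup)

    near : ∃[ k ] s - 1ℝ < fromℕ k
    near with least (x-1<x s)
    ... | _ , (k , refl , _) , q = k , q

    n = proj₁ near

    s<1+n : s < fromℕ (suc n)
    s<1+n = subst₂ _<_ (x-y+y s 1ℝ) (+-comm (fromℕ n) 1ℝ)
              (+-monoˡ-< 1ℝ (proj₂ near))

    x<1+n : x < fromℕ (suc n)
    x<1+n with x <? fromℕ (suc n)
    ... | yes p = p
    ... | no ¬p = contradiction
            (<-≤-trans s<1+n (upper (suc n , refl , ≮⇒≥ ¬p))) (<-irrefl refl)

  ^-pos : ∀ {x} n → 0ℝ < x → 0ℝ < x ^ n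
  ^-pos zero    p = 0<1
  ^-pos (suc n) p = *-pos p (^-pos n p)

  ^-monoˡ-≤ : ∀ {x y} n → 0ℝ < x → x ≤ y → x ^ n ≤ y ^ n
  ^-monoˡ-≤ zero    0<x p = inj₂ refl
  ^-monoˡ-≤ (suc n) 0<x p =
    ≤-trans (*-monoˡ-≤ (^-pos n 0<x) p)
            (*-monoʳ-≤ (<-≤-trans 0<x p) (^-monoˡ-≤ n 0<x p))

  0<2 : 0ℝ < fromℕ 2
  0<2 = fromℕ-pos 2

  2*x : ∀ x → fromℕ 2 * x ≡ x + x
  2*x x = trans (cong (λ y → (1ℝ + y) * x) (+-identityʳ 1ℝ))
            (trans (distribʳ x 1ℝ 1ℝ) (cong₂ _+_ (*-identityˡ x) (*-identityˡ x)))

  2^n<2^1+n : ∀ n → fromℕ 2 ^ n < fromℕ 2 ^ suc n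
  2^n<2^1+n n = subst₂ _<_ (+-identityʳ _) (sym (2*x _)) (+-monoʳ-< _ (^-pos n 0<2))

  1≤2^n : ∀ n → 1ℝ ≤ fromℕ 2 ^ n
  1≤2^n zero    = inj₂ refl
  1≤2^n (suc n) = ≤-trans (1≤2^n n) (inj₁ (2^n<2^1+n n))

  n≤2^n : ∀ n → fromℕ n ≤ fromℕ 2 ^ n
  n≤2^n zero    = inj₁ 0<1
  n≤2^n (suc n) = subst (fromℕ (suc n) ≤_) (sym (2*x _))
    (≤-trans (+-monoˡ-≤ (fromℕ n) (1≤2^n n)) (+-monoʳ-≤ (fromℕ 2 ^ n) (n≤2^n n)))

  2^-mono-≤ : ∀ {m n} → m ℕ.≤ n → fromℕ 2 ^ m ≤ fromℕ 2 ^ n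
  2^-mono-≤ {n = n} ℕ.z≤n = 1≤2^n n
  2^-mono-≤ (ℕ.s≤s p)     = *-monoʳ-≤ 0<2 (2^-mono-≤ p)

  2^-cancel-≤ : ∀ m n → fromℕ 2 ^ m ≤ fromℕ 2 ^ n → m ℕ.≤ n
  2^-cancel-≤ m n p with m ℕ.≤? n
  ... | yes q = q
  ... | no ¬q = contradiction
          (<-≤-trans (<-≤-trans (2^n<2^1+n n) (2^-mono-≤ (ℕ.≰⇒> ¬q))) p)
          (<-irrefl refl)

  -- The rationals q with 2^q ≤ x: here q = (a - a′) / b.
  Log₂Cut : ℝ → ℝ → Set
  Log₂Cut x q = ∃[ a ] ∃[ a′ ] ∃[ b ] NonZero b ×
    q ≡ (fromℕ a - fromℕ a′) / fromℕ b ×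
    fromℕ 2 ^ a ≤ fromℕ 2 ^ a′ * x ^ b

  log₂-nonempty : ∀ {x} → 0ℝ < x → ∃ (Log₂Cut x)
  log₂-nonempty {x} 0<x with archimedean (x ⁻¹)
  ... | N , x⁻¹<N = _ , 0 , N , 1 , _ , refl ,
        subst₂ _≤_ (trans (*-comm (x ⁻¹) x) (*-inverseʳ (0<⇒≢0 0<x)))
          (cong (fromℕ 2 ^ N *_) (sym (*-identityʳ x)))
          (*-monoˡ-≤ 0<x (≤-trans (inj₁ x⁻¹<N) (n≤2^n N)))

  log₂-bounded : ∀ {x} → 0ℝ < x → ∃[ u ] (∀ {q} → Log₂Cut x q → q ≤ u)
  log₂-bounded {x} 0<x with archimedean x
  ... | M , x<M = fromℕ M , bound
    where
    bound : ∀ {q} → Log₂Cut x q → q ≤ fromℕ M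
    bound (a , a′ , b , nz , refl , p) =
      subst ((fromℕ a - fromℕ a′) * fromℕ b ⁻¹ ≤_) Mb/b
        (*-monoˡ-≤ (⁻¹-pos 0<b) a-a′≤Mb)
      where
      0<b : 0ℝ < fromℕ b
      0<b = fromℕ-pos b {{nz}}

      Mb/b : fromℕ (M ℕ.* b) * fromℕ b ⁻¹ ≡ fromℕ M
      Mb/b = trans (cong (_* fromℕ b ⁻¹) (×1-homo-* M b))
               (trans (*-assoc _ _ _)
                 (trans (cong (fromℕ M *_) (*-inverseʳ (0<⇒≢0 0<b))) (*-identityʳ _)))

      2^a≤ : fromℕ 2 ^ a ≤ fromℕ 2 ^ (a′ ℕ.+ M ℕ.* b)
      2^a≤ = ≤-trans p (subst (fromℕ 2 ^ a′ * x ^ b ≤_)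
        (trans (cong (fromℕ 2 ^ a′ *_) (^-assocʳ (fromℕ 2) M b))
               (sym (^-homo-* (fromℕ 2) a′ (M ℕ.* b))))
        (*-monoʳ-≤ (^-pos a′ 0<2)
          (^-monoˡ-≤ b 0<x (≤-trans (inj₁ x<M) (n≤2^n M)))))

      a-a′≤Mb : fromℕ a - fromℕ a′ ≤ fromℕ (M ℕ.* b)
      a-a′≤Mb = subst (fromℕ a - fromℕ a′ ≤_)
        (trans (cong (_- fromℕ a′)
                 (trans (×-homo-+ 1ℝ a′ (M ℕ.* b)) (+-comm (fromℕ a′) (fromℕ (M ℕ.* b)))))
               (x+y-y _ _))
        (+-monoˡ-≤ (- fromℕ a′) (fromℕ-mono-≤ (2^-cancel-≤ a (a′ ℕ.+ M ℕ.* b) 2^a≤)))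

  log₂-sup : ∀ x → 0ℝ < x → ∃ (IsSupremum _<_ (Log₂Cut x))
  log₂-sup x 0<x = completeness (Log₂Cut x) (log₂-nonempty 0<x) (log₂-bounded 0<x)

  log₂ : ∀ x → 0ℝ < x → ℝ
  log₂ x 0<x = proj₁ (log₂-sup x 0<x)

  -- Polynomials in two variables: (c , i , j) is the monomial c xⁱ yʲ.
  Polynomial₂ : Set
  Polynomial₂ = List (ℝ × ℕ × ℕ)

  eval : Polynomial₂ → ℝ → ℝ → ℝ
  eval p x y = foldr (λ { (c , i , j) r → c * x ^ i * y ^ j + r }) 0ℝ p

-- [n] is Fin n.

module DistributionTesting (R : RealNumbers) where
  open RealNumbers R
  open RealProperties R
  open Algebra.Properties.Monoid.Sum +-monoid using (sum-replicate)
  open Algebra.Properties.Semiring.Mult semiring using (×-assoc-*)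

  record Distribution (n : ℕ) : Set where
    field
      mass   : Fin n → ℝ
      nonneg : ∀ i → 0ℝ ≤ mass i
      total  : sum mass ≡ 1ℝ

  open Distribution public

  measure : ∀ {n} → Distribution n → Subset n → ℝ
  measure μ A = sum λ i → if lookup A i then mass μ i else 0ℝ

  -- The probability that the conditional sampling oracle returns j on A.
  conditional : ∀ {n} → Distribution n → Subset n → Fin n → ℝ
  conditional μ A j =
    if lookup A j
    then (if does (0ℝ <? measure μ A) then mass μ j / measure μ A else 1ℝ / fromℕ ∣ A ∣)
    else 0ℝ

  distance : ∀ {n} → Distribution n → Distribution n → ℝ
  distance μ μ′ = 1ℝ / fromℕ 2 * sum λ i → abs (mass μ i - mass μ′ i)

  Property : Set₁
  Property = ∀ n .{{_ : NonZero n}} → Distribution n → Set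

  Far : Property → ℝ → ∀ n .{{_ : NonZero n}} → Distribution n → Set
  Far P ε n μ = ∀ μ′ → P n μ′ → ε ≤ distance μ μ′

  data Verdict : Set where
    accept reject : Verdict

  -- A randomized adaptive algorithm that draws exactly t conditional samples.
  -- Everything below a toss or a query may depend on its outcome, so each
  -- queried set and the verdict are functions of the samples and fair coin
  -- tosses seen so far.
  data Algorithm (n : ℕ) : ℕ → Set where
    output : Verdict → Algorithm n 0
    toss   : ∀ {t} → (Bool → Algorithm n t) → Algorithm n t
    query  : ∀ {t} (A : Subset n) → Nonempty A → (Fin n → Algorithm n t) →
             Algorithm n (suc t)

  outputProb : Verdict → Verdict → ℝ
  outputProb accept accept = 1ℝ
  outputProb accept reject = 0ℝ
  outputProb reject accept = 0ℝ
  outputProb reject reject = 1ℝ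

  -- The probability that the algorithm ends with verdict v when its oracle
  -- samples from μ.
  Pr : ∀ {n t} → Distribution n → Algorithm n t → Verdict → ℝ
  Pr μ (output w)    v = outputProb w v
  Pr μ (toss k)      v = 1ℝ / fromℕ 2 * (Pr μ (k true) v + Pr μ (k false) v)
  Pr μ (query A _ k) v = sum λ j → conditional μ A j * Pr μ (k j) v

  -- Only positive ε and δ are meaningful inputs.
  record AdaptiveTester (P : Property) : Set where
    field
      complexity : ℝ → ℝ → ℕ → ℕ
      algorithm  : ∀ ε δ n .{{_ : NonZero n}} → Algorithm n (complexity ε δ n)
      accepts    : ∀ {ε δ} → 0ℝ < ε → 0ℝ < δ → ∀ n .{{_ : NonZero n}} (μ : Distribution n) →
                   P n μ → 1ℝ - δ ≤ Pr μ (algorithm ε δ n) accept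
      rejects    : ∀ {ε δ} → 0ℝ < ε → 0ℝ < δ → ∀ n .{{_ : NonZero n}} (μ : Distribution n) →
                   Far P ε n μ → 1ℝ - δ ≤ Pr μ (algorithm ε δ n) reject

  U : ∀ n .{{_ : NonZero n}} → Distribution n
  U n = record
    { mass   = λ _ → 1ℝ / fromℕ n
    ; nonneg = λ _ → inj₁ (*-pos 0<1 (⁻¹-pos (fromℕ-pos n)))
    ; total  = trans (sum-replicate n)
                 (trans (sym (×-assoc-* n 1ℝ (fromℕ n ⁻¹)))
                        (*-inverseʳ (0<⇒≢0 (fromℕ-pos n))))
    }

  -- The property {U n}; distributions are compared pointwise.
  Uniform : Property
  Uniform n μ = ∀ i → mass μ i ≡ mass (U n) i

module Submission where

-- Why uniformity can be tested with a number of samples independent of n.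
--
-- Duel. Pick a challenger i uniformly from [n], a defender j from μ, and ask
-- the oracle for one sample of the pair i, j. With x = μ(i) and y = μ(j) the
-- defender wins with probability y / (x + y) if that is defined (winProb-odds;
-- if i = j a fair coin decides). Under the uniform distribution this is 1/2 for
-- every pair. In general it favours the defender, who was drawn with
-- probability y: the expectation over j and uniform i is
--   (1/n) sum over i, j of y * y / (x + y),
-- and bounding y * y / (x + y) below by the tangent 2 c y - c² (x + y) with
-- c = (1 - e s) / 2, where s is the sign of x - 1/n, makes the sum linear
-- (pair-bound). Adding up gives at least 1/2 + e²/2 as soon as μ has distance
-- at least e from uniform (sum-challengeProb). So two samples yield one biased
-- coin, and the guaranteed bias depends on e only.
--
-- Coin tosses. In general no finite number of fair coins yields a uniform
-- element of [n]. Reducing a k-bit number modulo n gives each i probability at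
-- least 1/n - 1/2^k, which costs at most half of the advantage once k is large
-- (voteProb-far), while in the uniform case every challenger leads to a fair
-- duel, so nothing is lost there (voteProb-uniform). Tosses are not samples, so
-- k may depend on n.
--
-- Amplification. Bet on the defender with initial capital δ, staking the
-- fraction γ of the capital in every round, and reject if the final capital is
-- at least 1. If the coin is fair, the capital is a martingale, and Markov's
-- inequality gives Pr[reject] ≤ δ whatever the number of rounds (bet-fair). If
-- the defender wins with probability at least 1/2 + γ, then every round
-- multiplies the expected reciprocal of the capital by at most 1 - γ². The
-- tester accepts only if this reciprocal exceeds 1, so by Markov's inequality
-- δ Pr[accept] ≤ (1 - γ²)^m after m rounds (bet-favourable). With γ = e²/4 and m
-- of order γ^(-2) log (1/δ) the right-hand side is at most δ² (decay).

open import Defs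
open import Algebra.Bundles using (CommutativeRing; RawRing)
import Algebra.Properties.AbelianGroup
import Algebra.Properties.CommutativeSemigroup
import Algebra.Properties.Ring
import Algebra.Properties.Semiring.Exp
import Algebra.Properties.Semiring.Mult
import Algebra.Properties.Semiring.Sum
import Algebra.Solver.Ring
open import Algebra.Solver.Ring.AlmostCommutativeRing
  using (fromCommutativeRing; _-Raw-AlmostCommutative⟶_)
open import Data.Bool using (Bool; true; false; if_then_else_; _∨_)
open import Data.Fin using (Fin; zero; suc; toℕ; _≟_)
import Data.Fin.Properties as Fin
open import Data.Fin.Subset using (Subset; Nonempty; ∣_∣; ⊤; ⁅_⁆; _∪_; _∈_)
import Data.Fin.Subset.Properties as Subset
open import Data.List using ([]; _∷_)
open import Data.Maybe using (Maybe; just; nothing)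
open import Data.Nat as ℕ using (ℕ; zero; suc; NonZero)
open import Data.Nat.DivMod using (_mod_; _%_; m%n<n; m<n⇒m%n≡m; [m+n]%n≡m%n; m≡m%n+[m/n]*n)
import Data.Nat.Properties as ℕ
open import Data.Product using (Σ-syntax; ∃-syntax; _×_; _,_; proj₁; proj₂)
open import Data.Sum using (inj₁; inj₂)
open import Data.Vec using ([]; _∷_; lookup)
open import Data.Vec.Properties using (lookup-zipWith; lookup-replicate; []=⇒lookup)
open import Function using (_∘_)
open import Level using (0ℓ)
open import Relation.Binary using (StrictPartialOrder; IsStrictTotalOrder; tri<; tri≈; tri>)
open import Relation.Binary.PropositionalEquality
import Relation.Binary.Reasoning.StrictPartialOrder
open import Relation.Nullary using (Dec; ¬_; yes; no; does; contradiction)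
open import Relation.Unary using (Decidable)

-- A ring solver for the reals

module RealSolver (R : RealNumbers) where
  open RealNumbers R
  private
    module ℝ = CommutativeRing commutativeRing
  open Algebra.Properties.Ring ℝ.ring using (-‿distribˡ-*; -‿distribʳ-*; -‿involutive)
  open Algebra.Properties.AbelianGroup ℝ.+-abelianGroup using (⁻¹-∙-comm; ε⁻¹≈ε)
  open Algebra.Properties.CommutativeSemigroup ℝ.+-commutativeSemigroup using (interchange)
  open Algebra.Properties.Semiring.Mult semiring using (×1-homo-*; ×-homo-+)
  open ≡-Reasoning

  difference : ℕ × ℕ → ℝ
  difference (a , b) = fromℕ a - fromℕ b

  -- Propositionally this is the difference, but (1 , 0) computes to 1ℝ and any
  -- other (a , 0) to fromℕ a, so that literals match the goals they occur in.
  ⟦_⟧ : ℕ × ℕ → ℝ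
  ⟦ 1 , 0     ⟧ = 1ℝ
  ⟦ a , 0     ⟧ = fromℕ a
  ⟦ a , suc b ⟧ = difference (a , suc b)

  ⟦⟧-difference : ∀ p → ⟦ p ⟧ ≡ difference p
  ⟦⟧-difference (0 , 0)           = sym (-‿inverseʳ 0ℝ)
  ⟦⟧-difference (1 , 0)           = sym (trans (cong (fromℕ 1 +_) ε⁻¹≈ε)
                                      (trans (+-identityʳ _) (+-identityʳ 1ℝ)))
  ⟦⟧-difference (suc (suc a) , 0) = sym (trans (cong (fromℕ (suc (suc a)) +_) ε⁻¹≈ε)
                                      (+-identityʳ _))
  ⟦⟧-difference (0 , suc b)           = refl
  ⟦⟧-difference (1 , suc b)           = refl
  ⟦⟧-difference (suc (suc a) , suc b) = refl

  open RealProperties R using (x+y-y)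

  shift : ∀ x y z w → x + w ≡ z + y → x - y ≡ z - w
  shift x y z w p = begin
    x - y             ≡⟨ cong (_- y) (x+y-y x w) ⟨
    x + w - w - y     ≡⟨ cong (λ u → u - w - y) p ⟩
    z + y - w - y     ≡⟨ +-assoc _ _ _ ⟩
    z + y + (- w - y) ≡⟨ cong (z + y +_) (+-comm _ _) ⟩
    z + y + (- y - w) ≡⟨ +-assoc _ _ _ ⟨
    z + y - y - w     ≡⟨ cong (_- w) (x+y-y z y) ⟩
    z - w             ∎

  reduce : ℕ × ℕ → ℕ × ℕ
  reduce (a , b) = a ℕ.∸ b , b ℕ.∸ a

  difference-reduce : ∀ a b → difference (reduce (a , b)) ≡ difference (a , b)
  difference-reduce zero    zero    = refl
  difference-reduce zero    (suc b) = refl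
  difference-reduce (suc a) zero    = refl
  difference-reduce (suc a) (suc b) = trans (difference-reduce a b)
    (shift _ _ _ _ (trans (sym (+-assoc _ _ _)) (cong (_+ fromℕ b) (+-comm _ _))))

  -- Coefficients taken from ℝ would not compute. These are the integers, as
  -- differences of naturals reduced to make equal coefficients identical.
  coefficients : RawRing 0ℓ 0ℓ
  coefficients = record
    { Carrier = ℕ × ℕ
    ; _≈_     = _≡_
    ; _+_     = λ (a , b) (c , d) → reduce (a ℕ.+ c , b ℕ.+ d)
    ; _*_     = λ (a , b) (c , d) → reduce (a ℕ.* c ℕ.+ b ℕ.* d , a ℕ.* d ℕ.+ b ℕ.* c)
    ; -_      = λ (a , b) → b , a
    ; 0#      = 0 , 0
    ; 1#      = 1 , 0
    }
  private module C = RawRing coefficients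

  -‿+ : ∀ x y → - (x + y) ≡ - x + - y
  -‿+ x y = sym (⁻¹-∙-comm x y)

  difference-+ : ∀ p q → difference (p C.+ q) ≡ difference p + difference q
  difference-+ (a , b) (c , d) = begin
    difference (reduce (a ℕ.+ c , b ℕ.+ d))     ≡⟨ difference-reduce (a ℕ.+ c) (b ℕ.+ d) ⟩
    fromℕ (a ℕ.+ c) - fromℕ (b ℕ.+ d)           ≡⟨ cong₂ _-_ (×-homo-+ 1ℝ a c) (×-homo-+ 1ℝ b d) ⟩
    fromℕ a + fromℕ c - (fromℕ b + fromℕ d)     ≡⟨ cong (fromℕ a + fromℕ c +_) (-‿+ _ _) ⟩
    fromℕ a + fromℕ c + (- fromℕ b + - fromℕ d) ≡⟨ interchange _ _ _ _ ⟩
    fromℕ a - fromℕ b + (fromℕ c - fromℕ d)     ∎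

  difference-neg : ∀ p → difference (C.- p) ≡ - difference p
  difference-neg (a , b) = sym (begin
    - (fromℕ a - fromℕ b)     ≡⟨ -‿+ _ _ ⟩
    - fromℕ a + - - fromℕ b   ≡⟨ cong (- fromℕ a +_) (-‿involutive _) ⟩
    - fromℕ a + fromℕ b       ≡⟨ +-comm _ _ ⟩
    fromℕ b - fromℕ a         ∎)

  fromℕ-dot : ∀ a b c d → fromℕ (a ℕ.* b ℕ.+ c ℕ.* d) ≡ fromℕ a * fromℕ b + fromℕ c * fromℕ d
  fromℕ-dot a b c d = trans (×-homo-+ 1ℝ (a ℕ.* b) (c ℕ.* d))
                        (cong₂ _+_ (×1-homo-* a b) (×1-homo-* c d))

  difference-* : ∀ p q → difference (p C.* q) ≡ difference p * difference q
  difference-* (a , b) (c , d) = begin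
    difference (reduce (a ℕ.* c ℕ.+ b ℕ.* d , a ℕ.* d ℕ.+ b ℕ.* c))
      ≡⟨ difference-reduce (a ℕ.* c ℕ.+ b ℕ.* d) (a ℕ.* d ℕ.+ b ℕ.* c) ⟩
    fromℕ (a ℕ.* c ℕ.+ b ℕ.* d) - fromℕ (a ℕ.* d ℕ.+ b ℕ.* c)
      ≡⟨ cong₂ _-_ (fromℕ-dot a c b d) (fromℕ-dot a d b c) ⟩
    A * C + B * D - (A * D + B * C)
      ≡⟨ cong (A * C + B * D +_) (-‿+ _ _) ⟩
    A * C + B * D + (- (A * D) + - (B * C))
      ≡⟨ cong (A * C + B * D +_) (+-comm _ _) ⟩
    A * C + B * D + (- (B * C) + - (A * D))
      ≡⟨ interchange _ _ _ _ ⟩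
    A * C + - (B * C) + (B * D + - (A * D))
      ≡⟨ cong₂ _+_ (cong (A * C +_) (-‿distribˡ-* B C))
                   (trans (+-comm _ _) (cong₂ _+_ (-‿distribʳ-* A D) neg-neg)) ⟩
    A * C + - B * C + (A * - D + - B * - D)
      ≡⟨ cong₂ _+_ (distribʳ C A (- B)) (distribʳ (- D) A (- B)) ⟨
    (A - B) * C + (A - B) * - D
      ≡⟨ distribˡ (A - B) C (- D) ⟨
    (A - B) * (C - D) ∎
    where
    A = fromℕ a
    B = fromℕ b
    C = fromℕ c
    D = fromℕ d
    neg-neg : B * D ≡ - B * - D
    neg-neg = trans (sym (-‿involutive _))
                (trans (cong -_ (-‿distribˡ-* B D)) (-‿distribʳ-* (- B) D))

  morphism : coefficients -Raw-AlmostCommutative⟶ fromCommutativeRing commutativeRing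
  morphism = record
    { ⟦_⟧    = ⟦_⟧
    ; +-homo = λ p q → trans (⟦⟧-difference (p C.+ q)) (trans (difference-+ p q)
                 (sym (cong₂ _+_ (⟦⟧-difference p) (⟦⟧-difference q))))
    ; *-homo = λ p q → trans (⟦⟧-difference (p C.* q)) (trans (difference-* p q)
                 (sym (cong₂ _*_ (⟦⟧-difference p) (⟦⟧-difference q))))
    ; -‿homo = λ p → trans (⟦⟧-difference (C.- p)) (trans (difference-neg p)
                 (sym (cong -_ (⟦⟧-difference p))))
    ; 0-homo = refl
    ; 1-homo = refl
    }

  coefficient≟ : ∀ p q → Maybe (⟦ p ⟧ ≡ ⟦ q ⟧)
  coefficient≟ p@(a , b) q@(c , d) with a ℕ.+ d ℕ.≟ c ℕ.+ b
  ... | no  _ = nothing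
  ... | yes r = just (trans (⟦⟧-difference p) (trans
          (shift _ _ _ _ (trans (sym (×-homo-+ 1ℝ a d)) (trans (cong fromℕ r) (×-homo-+ 1ℝ c b))))
          (sym (⟦⟧-difference q))))

  open Algebra.Solver.Ring coefficients (fromCommutativeRing commutativeRing)
    morphism coefficient≟ public
    using (Polynomial; solve; con; _:=_; _:+_; _:*_; _:-_; :-_)

  lit : ∀ {m} → ℕ → Polynomial m
  lit n = con (n , 0)

-- Ordered field arithmetic

module OrderedField (R : RealNumbers) where
  open RealNumbers R
  open RealProperties R
  open RealSolver R

  strictPartialOrder : StrictPartialOrder 0ℓ 0ℓ 0ℓ
  strictPartialOrder = record
    { isStrictPartialOrder = IsStrictTotalOrder.isStrictPartialOrder isStrictTotalOrder }

  module ≤-Reasoning = Relation.Binary.Reasoning.StrictPartialOrder strictPartialOrder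

  ≤-reflexive : ∀ {x y} → x ≡ y → x ≤ y
  ≤-reflexive = inj₂

  <⇒≤ : ∀ {x y} → x < y → x ≤ y
  <⇒≤ = inj₁

  ≤⇒≯ : ∀ {x y} → x ≤ y → ¬ y < x
  ≤⇒≯ x≤y y<x = <-irrefl refl (<-≤-trans y<x x≤y)

  ≤-antisym : ∀ {x y} → x ≤ y → y ≤ x → x ≡ y
  ≤-antisym (inj₁ x<y) y≤x = contradiction x<y (≤⇒≯ y≤x)
  ≤-antisym (inj₂ x≡y) _   = x≡y

  +-mono-≤ : ∀ {x y z w} → x ≤ y → z ≤ w → x + z ≤ y + w
  +-mono-≤ {y = y} {z} p q = ≤-trans (+-monoˡ-≤ z p) (+-monoʳ-≤ y q)

  +-nonneg : ∀ {x y} → 0ℝ ≤ x → 0ℝ ≤ y → 0ℝ ≤ x + y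
  +-nonneg {x} {y} p q = subst (_≤ x + y) (+-identityʳ 0ℝ) (+-mono-≤ p q)

  -- Naming the slack z of an inequality leaves an identity, which the ring
  -- solver can prove.
  ≤-slack : ∀ {x y} z → 0ℝ ≤ z → x + z ≡ y → x ≤ y
  ≤-slack {x} {y} z 0≤z p = subst₂ _≤_ (+-identityʳ x) p (+-monoʳ-≤ x 0≤z)

  slack : ∀ {x y} → x ≤ y → 0ℝ ≤ y - x
  slack {x} {y} p = subst (_≤ y - x) (-‿inverseʳ x) (+-monoˡ-≤ (- x) p)

  *-monoʳ-≤-nonneg : ∀ {x y z} → 0ℝ ≤ z → x ≤ y → z * x ≤ z * y
  *-monoʳ-≤-nonneg (inj₁ 0<z) p = *-monoʳ-≤ 0<z p
  *-monoʳ-≤-nonneg {x} {y} (inj₂ refl) _ = ≤-reflexive (trans (zeroˡ x) (sym (zeroˡ y)))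

  *-monoˡ-≤-nonneg : ∀ {x y z} → 0ℝ ≤ z → x ≤ y → x * z ≤ y * z
  *-monoˡ-≤-nonneg {x} {y} {z} 0≤z p =
    subst₂ _≤_ (*-comm z x) (*-comm z y) (*-monoʳ-≤-nonneg 0≤z p)

  *-mono-≤ : ∀ {x y z w} → 0ℝ ≤ x → 0ℝ ≤ z → x ≤ y → z ≤ w → x * z ≤ y * w
  *-mono-≤ 0≤x 0≤z p q = ≤-trans (*-monoˡ-≤-nonneg 0≤z p) (*-monoʳ-≤-nonneg (≤-trans 0≤x p) q)

  *-nonneg : ∀ {x y} → 0ℝ ≤ x → 0ℝ ≤ y → 0ℝ ≤ x * y
  *-nonneg {x} {y} p q = subst (_≤ x * y) (zeroʳ x) (*-monoʳ-≤-nonneg p q)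

  *-cancelˡ-≤ : ∀ {x y z} → 0ℝ < z → z * x ≤ z * y → x ≤ y
  *-cancelˡ-≤ {x} {y} {z} 0<z p = ≮⇒≥ λ y<x →
    ≤⇒≯ p (subst₂ _<_ (*-comm y z) (*-comm x z) (*-monoˡ-< 0<z y<x))

  *-cancelˡ-≡ : ∀ {x y z} → 0ℝ < z → z * x ≡ z * y → x ≡ y
  *-cancelˡ-≡ 0<z p =
    ≤-antisym (*-cancelˡ-≤ 0<z (≤-reflexive p)) (*-cancelˡ-≤ 0<z (≤-reflexive (sym p)))

  square-nonneg : ∀ x → 0ℝ ≤ x * x
  square-nonneg x with compare x 0ℝ
  ... | tri> _ _ 0<x  = <⇒≤ (*-pos 0<x 0<x)
  ... | tri≈ _ refl _ = ≤-reflexive (sym (zeroˡ 0ℝ))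
  ... | tri< x<0 _ _  = subst (0ℝ ≤_) (solve 1 (λ x → :- x :* :- x := x :* x) refl x)
          (*-nonneg 0≤-x 0≤-x)
    where
    0≤-x : 0ℝ ≤ - x
    0≤-x = subst (0ℝ ≤_) (+-identityˡ (- x)) (slack (<⇒≤ x<0))

  0≤1 : 0ℝ ≤ 1ℝ
  0≤1 = <⇒≤ 0<1

  fromℕ-* : ∀ m n → fromℕ (m ℕ.* n) ≡ fromℕ m * fromℕ n
  fromℕ-* = Algebra.Properties.Semiring.Mult.×1-homo-* semiring

  fromℕ-2^ : ∀ n → fromℕ (2 ℕ.^ n) ≡ fromℕ 2 ^ n
  fromℕ-2^ zero    = +-identityʳ 1ℝ
  fromℕ-2^ (suc n) = trans (fromℕ-* 2 (2 ℕ.^ n)) (cong (fromℕ 2 *_) (fromℕ-2^ n))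

  0<1+x : ∀ {x} → 0ℝ < x → 0ℝ < 1ℝ + x
  0<1+x {x} 0<x = <-≤-trans 0<1 (≤-slack x (<⇒≤ 0<x) refl)

  0<1-x : ∀ {x} → x < 1ℝ → 0ℝ < 1ℝ - x
  0<1-x {x} x<1 = subst (_< 1ℝ - x) (-‿inverseʳ x) (+-monoˡ-< (- x) x<1)

  0<1-x² : ∀ {x} → 0ℝ < x → x < 1ℝ → 0ℝ < 1ℝ - x * x
  0<1-x² {x} 0<x x<1 =
    subst (0ℝ <_) (solve 1 (λ x → (lit 1 :- x) :* (lit 1 :+ x) := lit 1 :- x :* x) refl x)
      (*-pos (0<1-x x<1) (0<1+x 0<x))

  ½ : ℝ
  ½ = 1ℝ / fromℕ 2

  2*½ : fromℕ 2 * ½ ≡ 1ℝ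
  2*½ = trans (cong (fromℕ 2 *_) (*-identityˡ _)) (*-inverseʳ (0<⇒≢0 0<2))

  0<½ : 0ℝ < ½
  0<½ = *-pos 0<1 (⁻¹-pos 0<2)

  -- The expectation of a variable equal to x with probability p and to y
  -- otherwise.
  mix : ℝ → ℝ → ℝ → ℝ
  mix p x y = p * x + (1ℝ - p) * y

-- Finite sums

module FiniteSums (R : RealNumbers) where
  open RealNumbers R
  open RealProperties R
  open RealSolver R
  open OrderedField R
  open Algebra.Properties.Semiring.Sum semiring using
    (sum-cong-≗; sum-replicate-zero; ∑-distrib-+; *-distribˡ-sum) public
  open ≡-Reasoning

  sum-mono : ∀ {n} {f g : Fin n → ℝ} → (∀ i → f i ≤ g i) → sum f ≤ sum g
  sum-mono {zero}  p = ≤-reflexive refl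
  sum-mono {suc n} p = +-mono-≤ (p zero) (sum-mono (p ∘ suc))

  sum-nonneg : ∀ {n} {f : Fin n → ℝ} → (∀ i → 0ℝ ≤ f i) → 0ℝ ≤ sum f
  sum-nonneg {n} {f} p = subst (_≤ sum f) (sum-replicate-zero n) (sum-mono p)

  sum-const : ∀ n x → sum {n} (λ _ → x) ≡ fromℕ n * x
  sum-const zero    x = sym (zeroˡ x)
  sum-const (suc n) x = trans (cong₂ _+_ (sym (*-identityˡ x)) (sum-const n x))
                          (sym (distribʳ x 1ℝ (fromℕ n)))

  sum-linear : ∀ {n} (f g : Fin n → ℝ) x y →
               sum (λ i → x * f i + y * g i) ≡ x * sum f + y * sum g
  sum-linear f g x y = trans (∑-distrib-+ (λ i → x * f i) (λ i → y * g i))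
    (cong₂ _+_ (sym (*-distribˡ-sum x f)) (sym (*-distribˡ-sum y g)))

  sum-select : ∀ {n} (j : Fin n) (f : Fin n → ℝ) →
               sum (λ i → if does (i ≟ j) then f i else 0ℝ) ≡ f j
  sum-select {suc n} zero f = trans (cong (f zero +_) (sum-replicate-zero n)) (+-identityʳ _)
  sum-select (suc j) f = trans (+-identityˡ _) (sum-select j (f ∘ suc))

  term≤sum : ∀ {n} {f : Fin n → ℝ} → (∀ i → 0ℝ ≤ f i) → ∀ j → f j ≤ sum f
  term≤sum {f = f} p j = subst (_≤ sum f) (sum-select j f) (sum-mono selected)
    where
    selected : ∀ i → (if does (i ≟ j) then f i else 0ℝ) ≤ f i
    selected i with does (i ≟ j)
    ... | true  = ≤-reflexive refl
    ... | false = p i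

  -- Choosing at random among coins that lead to the same two outcomes amounts to
  -- tossing one coin with the averaged bias.
  sum-mix : ∀ {n} (w p : Fin n → ℝ) x y → sum w ≡ 1ℝ →
            sum (λ j → w j * mix (p j) x y) ≡ mix (sum λ j → w j * p j) x y
  sum-mix w p x y Σw≡1 = begin
    sum (λ j → w j * mix (p j) x y)
      ≡⟨ sum-cong-≗ (λ j → solve 4 (λ w p x y →
           w :* (p :* x :+ (lit 1 :- p) :* y) := (x :- y) :* (w :* p) :+ y :* w)
           refl (w j) (p j) x y) ⟩
    sum (λ j → (x - y) * (w j * p j) + y * w j)
      ≡⟨ sum-linear (λ j → w j * p j) w (x - y) y ⟩
    (x - y) * q + y * sum w
      ≡⟨ cong (λ s → (x - y) * q + y * s) Σw≡1 ⟩
    (x - y) * q + y * 1ℝ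
      ≡⟨ solve 3 (λ q x y → (x :- y) :* q :+ y :* lit 1 := q :* x :+ (lit 1 :- q) :* y)
           refl q x y ⟩
    mix q x y ∎
    where
    q = sum λ j → w j * p j

-- The conditional sampling oracle

module Oracle (R : RealNumbers) where
  open RealNumbers R
  open RealProperties R
  open DistributionTesting R
  open RealSolver R
  open OrderedField R
  open FiniteSums R

  restricted-nonneg : ∀ {n} (μ : Distribution n) A i →
                      0ℝ ≤ (if lookup A i then mass μ i else 0ℝ)
  restricted-nonneg μ A i with lookup A i
  ... | true  = nonneg μ i
  ... | false = ≤-reflexive refl

  measure-nonneg : ∀ {n} (μ : Distribution n) A → 0ℝ ≤ measure μ A
  measure-nonneg μ A = sum-nonneg (restricted-nonneg μ A)

  mass≤measure : ∀ {n} (μ : Distribution n) A {j} → lookup A j ≡ true → mass μ j ≤ measure μ A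
  mass≤measure μ A {j} j∈A =
    subst (_≤ measure μ A) (cong (if_then mass μ j else 0ℝ) j∈A)
      (term≤sum (restricted-nonneg μ A) j)

  size-pos : ∀ {n} {A : Subset n} {i} → i ∈ A → 0ℝ < fromℕ ∣ A ∣
  size-pos {A = A} i∈A = fromℕ-pos ∣ A ∣ {{ℕ.>-nonZero (ℕ.m<n⇒0<n (Subset.x∈p⇒∣p-x∣<∣p∣ i∈A))}}

  conditional-nonneg : ∀ {n} (μ : Distribution n) A → Nonempty A → ∀ j → 0ℝ ≤ conditional μ A j
  conditional-nonneg μ A (i , i∈A) j with lookup A j
  ... | false = ≤-reflexive refl
  ... | true with 0ℝ <? measure μ A
  ...   | yes 0<M = *-nonneg (nonneg μ j) (<⇒≤ (⁻¹-pos 0<M))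
  ...   | no  _   = <⇒≤ (*-pos 0<1 (⁻¹-pos (size-pos i∈A)))

  -- If A has no mass then neither has j, so this form of the conditional
  -- probability does not distinguish the two modes of the oracle.
  conditional-measure : ∀ {n} (μ : Distribution n) A {j} → lookup A j ≡ true →
                        conditional μ A j * measure μ A ≡ mass μ j
  conditional-measure μ A {j} j∈A with lookup A j in eq
  ... | true with 0ℝ <? measure μ A
  ...   | yes 0<M = trans (solve 3 (λ x y z → x :* y :* z := x :* (z :* y)) refl _ _ _)
                      (trans (cong (mass μ j *_) (*-inverseʳ (0<⇒≢0 0<M))) (*-identityʳ _))
  ...   | no  0≮M = trans (cong (_ *_) M≡0) (trans (zeroʳ _) (sym (≤-antisym
                      (subst (mass μ j ≤_) M≡0 (mass≤measure μ A eq)) (nonneg μ j))))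
    where
    M≡0 : measure μ A ≡ 0ℝ
    M≡0 = ≤-antisym (≮⇒≥ 0≮M) (measure-nonneg μ A)

  sum-indicator : ∀ {n} (A : Subset n) x →
                  sum (λ i → if lookup A i then x else 0ℝ) ≡ fromℕ ∣ A ∣ * x
  sum-indicator []          x = sym (zeroˡ x)
  sum-indicator (false ∷ A) x = trans (+-identityˡ _) (sum-indicator A x)
  sum-indicator (true ∷ A)  x = trans (cong₂ _+_ (sym (*-identityˡ x)) (sum-indicator A x))
                                  (sym (distribʳ x 1ℝ (fromℕ ∣ A ∣)))

  -- With positive measure the masses in A are divided by their sum; otherwise A
  -- has ∣ A ∣ equally likely members.
  sum-conditional : ∀ {n} (μ : Distribution n) A → Nonempty A → sum (conditional μ A) ≡ 1ℝ
  sum-conditional μ A (i , i∈A) with 0ℝ <? measure μ A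
  ... | yes 0<M = trans (sum-cong-≗ scaled) (trans (sym (*-distribˡ-sum (measure μ A ⁻¹)
                      (λ j → if lookup A j then mass μ j else 0ℝ)))
                    (trans (*-comm (measure μ A ⁻¹) (measure μ A)) (*-inverseʳ (0<⇒≢0 0<M))))
    where
    scaled : ∀ j → (if lookup A j then mass μ j / measure μ A else 0ℝ) ≡
                   measure μ A ⁻¹ * (if lookup A j then mass μ j else 0ℝ)
    scaled j with lookup A j
    ... | true  = *-comm _ _
    ... | false = sym (zeroʳ _)
  ... | no  _   = trans (sum-indicator A _) (trans (cong (fromℕ ∣ A ∣ *_) (*-identityˡ _))
                    (*-inverseʳ (0<⇒≢0 (size-pos i∈A))))

  conditional≤1 : ∀ {n} (μ : Distribution n) A → Nonempty A → ∀ j → conditional μ A j ≤ 1ℝ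
  conditional≤1 μ A A≠∅ j =
    subst (conditional μ A j ≤_) (sum-conditional μ A A≠∅) (term≤sum (conditional-nonneg μ A A≠∅) j)

  conditional-⊤ : ∀ {n} (μ : Distribution n) j → conditional μ ⊤ j ≡ mass μ j
  conditional-⊤ {n} μ j = trans (sym (*-identityʳ _))
    (trans (cong (conditional μ ⊤ j *_) (sym measure-⊤))
           (conditional-measure μ ⊤ {j} (lookup-replicate j true)))
    where
    measure-⊤ : measure μ ⊤ ≡ 1ℝ
    measure-⊤ = trans (sum-cong-≗ (λ i → cong (if_then mass μ i else 0ℝ) (lookup-replicate i true)))
                  (total μ)

  lookup-⁅⁆ : ∀ {n} (i j : Fin n) → lookup ⁅ j ⁆ i ≡ does (i ≟ j)
  lookup-⁅⁆ zero    zero    = refl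
  lookup-⁅⁆ (suc i) zero    = lookup-replicate i false
  lookup-⁅⁆ zero    (suc j) = refl
  lookup-⁅⁆ (suc i) (suc j) = lookup-⁅⁆ i j

  measure-pair : ∀ {n} (μ : Distribution n) {i j} → i ≢ j →
                 measure μ (⁅ i ⁆ ∪ ⁅ j ⁆) ≡ mass μ i + mass μ j
  measure-pair μ {i} {j} i≢j = trans (sum-cong-≗ split)
    (trans (∑-distrib-+ (λ l → if does (l ≟ i) then mass μ l else 0ℝ)
                        (λ l → if does (l ≟ j) then mass μ l else 0ℝ))
           (cong₂ _+_ (sum-select i (mass μ)) (sum-select j (mass μ))))
    where
    split : ∀ l → (if lookup (⁅ i ⁆ ∪ ⁅ j ⁆) l then mass μ l else 0ℝ) ≡
                  (if does (l ≟ i) then mass μ l else 0ℝ) +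
                  (if does (l ≟ j) then mass μ l else 0ℝ)
    split l rewrite lookup-zipWith _∨_ l ⁅ i ⁆ ⁅ j ⁆ | lookup-⁅⁆ l i | lookup-⁅⁆ l j
      with l ≟ i | l ≟ j
    ... | yes refl | yes refl = contradiction refl i≢j
    ... | yes _    | no _     = sym (+-identityʳ _)
    ... | no _     | yes _    = sym (+-identityˡ _)
    ... | no _     | no _     = sym (+-identityˡ _)

  -- Duels

  j∈pair : ∀ {n} (i j : Fin n) → j ∈ (⁅ i ⁆ ∪ ⁅ j ⁆)
  j∈pair i j = Subset.x∈p∪q⁺ (inj₂ (Subset.x∈⁅x⁆ j))

  -- Passes on whether the defender j beats the challenger i. In a duel of i with
  -- itself the sample says nothing and a fair coin decides, but it is still
  -- drawn, so that all branches use the same number of samples.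
  duel : ∀ {n t} → Fin n → Fin n → (Bool → Algorithm n t) → Algorithm n (suc t)
  duel i j k = query (⁅ i ⁆ ∪ ⁅ j ⁆) (j , j∈pair i j) λ l →
    if does (i ≟ j) then toss k else k (does (l ≟ j))

  winProb : ∀ {n} → Distribution n → Fin n → Fin n → ℝ
  winProb μ i j = if does (i ≟ j) then ½ else conditional μ (⁅ i ⁆ ∪ ⁅ j ⁆) j

  winProb-nonneg : ∀ {n} (μ : Distribution n) i j → 0ℝ ≤ winProb μ i j
  winProb-nonneg μ i j with does (i ≟ j)
  ... | true  = <⇒≤ 0<½
  ... | false = conditional-nonneg μ (⁅ i ⁆ ∪ ⁅ j ⁆) (j , j∈pair i j) j

  ½≤1 : ½ ≤ 1ℝ
  ½≤1 = ≤-slack ½ (<⇒≤ 0<½) (trans (sym (2*x ½)) 2*½)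

  winProb≤1 : ∀ {n} (μ : Distribution n) i j → winProb μ i j ≤ 1ℝ
  winProb≤1 μ i j with does (i ≟ j)
  ... | true  = ½≤1
  ... | false = conditional≤1 μ (⁅ i ⁆ ∪ ⁅ j ⁆) (j , j∈pair i j) j

  -- In this form the case i = j and pairs without mass are no exceptions.
  winProb-odds : ∀ {n} (μ : Distribution n) i j →
                 winProb μ i j * (mass μ i + mass μ j) ≡ mass μ j
  winProb-odds μ i j with i ≟ j
  ... | yes refl = trans (solve 2 (λ h x → h :* (x :+ x) := lit 2 :* h :* x) refl ½ (mass μ i))
                     (trans (cong (_* mass μ i) 2*½) (*-identityˡ _))
  ... | no i≢j   = trans (cong (conditional μ (⁅ i ⁆ ∪ ⁅ j ⁆) j *_) (sym (measure-pair μ i≢j)))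
                     (conditional-measure μ (⁅ i ⁆ ∪ ⁅ j ⁆) ([]=⇒lookup (j∈pair i j)))

  mix-½ : ∀ x y → ½ * (x + y) ≡ mix ½ x y
  mix-½ x y = trans
    (solve 3 (λ h x y → h :* (x :+ y) := h :* x :+ (lit 2 :* h :- h) :* y) refl ½ x y)
    (cong (λ o → ½ * x + (o - ½) * y) 2*½)

  Pr-duel : ∀ {n t} (μ : Distribution n) i j (k : Bool → Algorithm n t) v →
            Pr μ (duel i j k) v ≡ mix (winProb μ i j) (Pr μ (k true) v) (Pr μ (k false) v)
  Pr-duel {n} μ i j k v with i ≟ j
  ... | yes _ = trans (sum-cong-≗ (λ l → *-comm (c l) x)) (trans (sym (*-distribˡ-sum x c))
                  (trans (cong (x *_) (sum-conditional μ A A≠∅))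
                         (trans (*-identityʳ x) (mix-½ _ _))))
    where
    A = ⁅ i ⁆ ∪ ⁅ j ⁆
    A≠∅ = j , j∈pair i j
    c = conditional μ A
    x = ½ * (Pr μ (k true) v + Pr μ (k false) v)
  ... | no _  = trans (sum-cong-≗ pointwise) (trans (sum-linear _ c (x - y) y)
                  (trans (cong₂ (λ s t → (x - y) * s + y * t)
                                (sum-select j c) (sum-conditional μ A A≠∅))
                    (solve 3 (λ c x y → (x :- y) :* c :+ y :* lit 1 := c :* x :+ (lit 1 :- c) :* y)
                       refl (c j) x y)))
    where
    A = ⁅ i ⁆ ∪ ⁅ j ⁆
    A≠∅ = j , j∈pair i j
    c = conditional μ A
    x = Pr μ (k true) v
    y = Pr μ (k false) v
    pointwise : ∀ l → c l * Pr μ (k (does (l ≟ j))) v ≡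
                      (x - y) * (if does (l ≟ j) then c l else 0ℝ) + y * c l
    pointwise l with does (l ≟ j)
    ... | true  = solve 3 (λ c x y → c :* x := (x :- y) :* c :+ y :* c) refl (c l) x y
    ... | false = solve 3 (λ c x y → c :* y := (x :- y) :* lit 0 :+ y :* c) refl (c l) x y

  -- Random numbers from coin tosses

  -- A uniform k-bit number.
  draw : ∀ {n t} (k : ℕ) → (ℕ → Algorithm n t) → Algorithm n t
  draw zero    f = f 0
  draw (suc k) f = toss λ b → draw k λ x → f (if b then x else 2 ℕ.^ k ℕ.+ x)

  -- The mean over the numbers below 2 ^ k, in the shape that Pr gives to draw.
  average : ℕ → (ℕ → ℝ) → ℝ
  average zero    g = g 0
  average (suc k) g = ½ * (average k g + average k λ x → g (2 ℕ.^ k ℕ.+ x))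

  average-const : ∀ k {g} {c : ℝ} → (∀ x → g x ≡ c) → average k g ≡ c
  average-const zero    p = p 0
  average-const (suc k) p = trans
    (cong₂ (λ x y → ½ * (x + y)) (average-const k p) (average-const k (λ x → p _)))
    (trans (solve 2 (λ h c → h :* (c :+ c) := lit 2 :* h :* c) refl ½ _)
      (trans (cong (_* _) 2*½) (*-identityˡ _)))

  average≤1 : ∀ k {g} → (∀ x → g x ≤ 1ℝ) → average k g ≤ 1ℝ
  average≤1 zero    p = p 0
  average≤1 (suc k) p = ≤-trans
    (*-monoʳ-≤ 0<½ (+-mono-≤ (average≤1 k p) (average≤1 k (λ x → p _))))
    (≤-reflexive (trans (solve 1 (λ h → h :* (lit 1 :+ lit 1) := lit 2 :* h) refl ½) 2*½))

  average-nonneg : ∀ k {g} → (∀ x → 0ℝ ≤ g x) → 0ℝ ≤ average k g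
  average-nonneg zero    p = p 0
  average-nonneg (suc k) p =
    *-nonneg (<⇒≤ 0<½) (+-nonneg (average-nonneg k p) (average-nonneg k (λ x → p _)))

  Pr-draw : ∀ {n t} (μ : Distribution n) k (f : ℕ → Algorithm n t) v {p : ℕ → ℝ} {x y : ℝ} →
            (∀ m → Pr μ (f m) v ≡ mix (p m) x y) →
            Pr μ (draw k f) v ≡ mix (average k p) x y
  Pr-draw μ zero    f v eq = eq 0
  Pr-draw μ (suc k) f v {p} {x} {y} eq = trans
    (cong₂ (λ a b → ½ * (a + b)) (Pr-draw μ k _ v eq) (Pr-draw μ k _ v (λ m → eq _)))
    (trans (solve 5 (λ h a b x y →
              h :* (a :* x :+ (lit 1 :- a) :* y :+ (b :* x :+ (lit 1 :- b) :* y)) :=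
              h :* (a :+ b) :* x :+ (lit 2 :* h :- h :* (a :+ b)) :* y)
              refl ½ (average k p) (average k λ m → p (2 ℕ.^ k ℕ.+ m)) x y)
           (cong (λ o → average (suc k) p * x + (o - average (suc k) p) * y) 2*½))

  sum-+ : ∀ a {b} (g : ℕ → ℝ) →
          sum {a ℕ.+ b} (g ∘ toℕ) ≡ sum {a} (g ∘ toℕ) + sum {b} (λ i → g (a ℕ.+ toℕ i))
  sum-+ zero    g = sym (+-identityˡ _)
  sum-+ (suc a) g = trans (cong (g 0 +_) (sum-+ a (g ∘ suc))) (sym (+-assoc _ _ _))

  average-sum : ∀ k g → fromℕ (2 ℕ.^ k) * average k g ≡ sum {2 ℕ.^ k} (g ∘ toℕ)
  average-sum zero    g = solve 1 (λ x → (lit 1 :+ lit 0) :* x := x :+ lit 0) refl (g 0)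
  average-sum (suc k) g = trans (cong (_* average (suc k) g) (fromℕ-* 2 (2 ℕ.^ k)))
    (trans (solve 4 (λ B h a b →
              lit 2 :* B :* (h :* (a :+ b)) := lit 2 :* h :* (B :* a :+ B :* b)) refl B ½ _ _)
    (trans (cong₂ _*_ 2*½ (cong₂ _+_ (average-sum k g) (average-sum k g′)))
    (trans (*-identityˡ _)
    (trans (sym (sum-+ (2 ℕ.^ k) g))
           (cong (λ m → sum {2 ℕ.^ k ℕ.+ m} (g ∘ toℕ)) (sym (ℕ.+-identityʳ (2 ℕ.^ k))))))))
    where
    B = fromℕ (2 ℕ.^ k)
    g′ = λ x → g (2 ℕ.^ k ℕ.+ x)

  module _ {n : ℕ} .{{_ : NonZero n}} (h : Fin n → ℝ) where

    -- Each of the q blocks of n consecutive numbers meets every residue once.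
    sum-multiple-mod : ∀ q → sum {q ℕ.* n} (λ x → h (toℕ x mod n)) ≡ fromℕ q * sum h
    sum-multiple-mod zero    = sym (zeroˡ _)
    sum-multiple-mod (suc q) = trans (sum-+ n {q ℕ.* n} (λ x → h (x mod n)))
      (trans (cong₂ _+_
               (trans (sum-cong-≗ (λ i → cong h (toℕ-mod i))) (sym (*-identityˡ _)))
               (trans (sum-cong-≗ {q ℕ.* n} (λ i → cong h (n+-mod (toℕ i)))) (sum-multiple-mod q)))
             (sym (distribʳ _ 1ℝ (fromℕ q))))
      where
      toℕ-mod : ∀ (i : Fin n) → toℕ i mod n ≡ i
      toℕ-mod i = Fin.toℕ-injective (trans (Fin.toℕ-fromℕ< _) (m<n⇒m%n≡m (Fin.toℕ<n i)))
      n+-mod : ∀ x → (n ℕ.+ x) mod n ≡ x mod n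
      n+-mod x = Fin.toℕ-injective (trans (Fin.toℕ-fromℕ< _)
        (trans (cong (_% n) (ℕ.+-comm n x)) (trans ([m+n]%n≡m%n x n) (sym (Fin.toℕ-fromℕ< _)))))

    -- Divided by m n: a uniform number below m meets each residue with
    -- probability at least 1/n - 1/m, because m exceeds some multiple of n by
    -- less than n.
    sum-mod : (∀ i → 0ℝ ≤ h i) → ∀ m →
              fromℕ m * sum h ≤ fromℕ n * sum {m} (λ x → h (toℕ x mod n)) + fromℕ n * sum h
    sum-mod 0≤h m = begin
      fromℕ m * S
        ≡⟨ cong (λ x → fromℕ x * S) m≡qn+r ⟩
      fromℕ (q ℕ.* n ℕ.+ r) * S
        ≤⟨ *-monoˡ-≤-nonneg (sum-nonneg 0≤h)
             (fromℕ-mono-≤ (ℕ.+-monoʳ-≤ (q ℕ.* n) (ℕ.<⇒≤ (m%n<n m n)))) ⟩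
      fromℕ (q ℕ.* n ℕ.+ n) * S
        ≡⟨ cong (λ x → fromℕ x * S) (ℕ.+-comm (q ℕ.* n) n) ⟩
      fromℕ (suc q ℕ.* n) * S
        ≡⟨ cong (_* S) (fromℕ-* (suc q) n) ⟩
      (1ℝ + fromℕ q) * fromℕ n * S
        ≡⟨ solve 3 (λ q n s → (lit 1 :+ q) :* n :* s := n :* (q :* s) :+ n :* s)
             refl (fromℕ q) (fromℕ n) S ⟩
      fromℕ n * (fromℕ q * S) + fromℕ n * S
        ≤⟨ +-monoˡ-≤ _ (*-monoʳ-≤ (fromℕ-pos n) qS≤) ⟩
      fromℕ n * sum {m} (λ x → h (toℕ x mod n)) + fromℕ n * S ∎
      where
      open ≤-Reasoning
      S = sum h
      q = m ℕ./ n
      r = m % n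
      g = λ x → h (x mod n)
      m≡qn+r : m ≡ q ℕ.* n ℕ.+ r
      m≡qn+r = trans (m≡m%n+[m/n]*n m n) (ℕ.+-comm r _)
      qS≤ : fromℕ q * S ≤ sum {m} (g ∘ toℕ)
      qS≤ = subst (λ x → fromℕ q * S ≤ sum {x} (g ∘ toℕ)) (sym m≡qn+r)
        (subst₂ _≤_ (trans (+-identityʳ _) (sum-multiple-mod q)) (sym (sum-+ (q ℕ.* n) g))
          (+-monoʳ-≤ _ (sum-nonneg {r} (λ i → 0≤h _))))

-- The bias of a random duel

module Vote (R : RealNumbers) where
  open RealNumbers R
  open RealProperties R
  open DistributionTesting R
  open RealSolver R
  open OrderedField R
  open FiniteSums R
  open Oracle R

  sign : ℝ → ℝ
  sign z = if does (z <? 0ℝ) then - 1ℝ else 1ℝ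

  sign² : ∀ z → sign z * sign z ≡ 1ℝ
  sign² z with does (z <? 0ℝ)
  ... | true  = solve 0 (:- lit 1 :* :- lit 1 := lit 1) refl
  ... | false = *-identityˡ 1ℝ

  sign-abs : ∀ z → sign z * z ≡ abs z
  sign-abs z with does (z <? 0ℝ)
  ... | true  = solve 1 (λ z → :- lit 1 :* z := :- z) refl z
  ... | false = *-identityˡ z

  -- The inequality (x + y) (b - c)² ≥ 0 with c = (1 - e σ) / 2, multiplied by 4.
  -- As b (x + y) = y, it bounds y b below by 2 c y - c² (x + y), a linear form in
  -- x and y. The factor 1ℝ after x is there for sum-linear.
  pair-bound : ∀ e σ {x y b} → σ * σ ≡ 1ℝ → 0ℝ ≤ x + y → b * (x + y) ≡ y →
    (fromℕ 3 - e * e - fromℕ 2 * e * σ) * y + (fromℕ 2 * e * σ - 1ℝ - e * e) * x * 1ℝ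
      ≤ fromℕ 4 * (y * b)
  pair-bound e σ {x} {y} {b} σ²≡1 0≤x+y odds = ≤-slack
    ((x + y) * (t * t)) (*-nonneg 0≤x+y (square-nonneg t))
    -- The right-hand side singles out b * (x + y) and σ * σ for replacement.
    (trans (solve 5 (λ e σ x y b →
        (lit 3 :- e :* e :- lit 2 :* e :* σ) :* y
          :+ (lit 2 :* e :* σ :- lit 1 :- e :* e) :* x :* lit 1
          :+ (x :+ y) :* ((lit 2 :* b :- (lit 1 :- e :* σ)) :* (lit 2 :* b :- (lit 1 :- e :* σ)))
        := (lit 4 :* b :- lit 4 :* (lit 1 :- e :* σ)) :* (b :* (x :+ y))
           :+ e :* e :* (σ :* σ) :* (x :+ y)
           :+ (lit 4 :* (lit 1 :- e :* σ) :* y :- e :* e :* (x :+ y)))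
        refl e σ x y b)
    (trans (cong₂ (λ w s → (fromℕ 4 * b - fromℕ 4 * (1ℝ - e * σ)) * w + e * e * s * (x + y)
                           + (fromℕ 4 * (1ℝ - e * σ) * y - e * e * (x + y))) odds σ²≡1)
      (solve 5 (λ e σ x y b →
        (lit 4 :* b :- lit 4 :* (lit 1 :- e :* σ)) :* y :+ e :* e :* lit 1 :* (x :+ y)
           :+ (lit 4 :* (lit 1 :- e :* σ) :* y :- e :* e :* (x :+ y))
        := lit 4 :* (y :* b)) refl e σ x y b)))
    where
    t = fromℕ 2 * b - (1ℝ - e * σ)

  -- The probability that the challenger i loses to a defender drawn from μ.
  challengeProb : ∀ {n} → Distribution n → Fin n → ℝ
  challengeProb μ i = sum λ j → mass μ j * winProb μ i j

  challengeProb-nonneg : ∀ {n} (μ : Distribution n) i → 0ℝ ≤ challengeProb μ i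
  challengeProb-nonneg μ i = sum-nonneg λ j → *-nonneg (nonneg μ j) (winProb-nonneg μ i j)

  challengeProb≤1 : ∀ {n} (μ : Distribution n) i → challengeProb μ i ≤ 1ℝ
  challengeProb≤1 μ i = subst (challengeProb μ i ≤_) (total μ) (sum-mono λ j →
    subst (mass μ j * winProb μ i j ≤_) (*-identityʳ _)
      (*-monoʳ-≤-nonneg (nonneg μ j) (winProb≤1 μ i j)))

  -- pair-bound with y = mass μ j, summed over j; the masses add up to 1.
  challenge-bound : ∀ {n} (μ : Distribution n) e σ → σ * σ ≡ 1ℝ → ∀ i →
    (fromℕ 3 - e * e - fromℕ 2 * e * σ) + (fromℕ 2 * e * σ - 1ℝ - e * e) * mass μ i * fromℕ n
      ≤ fromℕ 4 * challengeProb μ i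
  challenge-bound {n} μ e σ σ²≡1 i = subst₂ _≤_
    (trans (sum-linear (mass μ) (λ _ → 1ℝ) a (c * mass μ i))
           (cong₂ _+_ (trans (cong (a *_) (total μ)) (*-identityʳ a))
                      (cong (c * mass μ i *_) (trans (sum-const n 1ℝ) (*-identityʳ _)))))
    (sym (*-distribˡ-sum (fromℕ 4) (λ j → mass μ j * winProb μ i j)))
    (sum-mono λ j → pair-bound e σ σ²≡1 (+-nonneg (nonneg μ i) (nonneg μ j)) (winProb-odds μ i j))
    where
    a = fromℕ 3 - e * e - fromℕ 2 * e * σ
    c = fromℕ 2 * e * σ - 1ℝ - e * e

  module _ {n : ℕ} .{{_ : NonZero n}} (μ : Distribution n) where

    private
      N = fromℕ n

    deviation : ℝ
    deviation = sum λ i → abs (mass μ i - mass (U n) i)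

    2*distance : fromℕ 2 * distance μ (U n) ≡ deviation
    2*distance = trans (sym (*-assoc (fromℕ 2) ½ deviation))
                   (trans (cong (_* deviation) 2*½) (*-identityˡ deviation))

    N/N : N * (1ℝ / N) ≡ 1ℝ
    N/N = trans (cong (N *_) (*-identityˡ _)) (*-inverseʳ (0<⇒≢0 (fromℕ-pos n)))

    -- Summing challenge-bound over i with σ the sign of z = mass μ i - 1/n, the
    -- terms with σ add up to 2 e n ∑ ∣ z ∣, which is 4 e n times the distance.
    sum-challengeProb : ∀ {e} → 0ℝ ≤ e → e ≤ distance μ (U n) →
                        N * (1ℝ + e * e) ≤ fromℕ 2 * sum (challengeProb μ)
    sum-challengeProb {e} 0≤e e≤d = *-cancelˡ-≤ 0<2 (begin
      fromℕ 2 * (N * (1ℝ + e * e))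
        ≡⟨ solve 2 (λ n e → lit 2 :* (n :* (lit 1 :+ e :* e)) :=
             n :* (lit 2 :- lit 2 :* (e :* e)) :+ lit 2 :* e :* n :* (lit 2 :* e)) refl N e ⟩
      N * (fromℕ 2 - fromℕ 2 * (e * e)) + fromℕ 2 * e * N * (fromℕ 2 * e)
        ≤⟨ +-monoʳ-≤ _ (*-monoʳ-≤-nonneg (*-nonneg (*-nonneg (<⇒≤ 0<2) 0≤e) (<⇒≤ (fromℕ-pos n)))
             (≤-trans (*-monoʳ-≤ 0<2 e≤d) (≤-reflexive 2*distance))) ⟩
      N * (fromℕ 2 - fromℕ 2 * (e * e)) + fromℕ 2 * e * N * sum Δ
        ≡⟨ solve 3 (λ n e s → n :* (lit 2 :- lit 2 :* (e :* e)) :+ lit 2 :* e :* n :* s :=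
             (lit 3 :- e :* e) :* n
               :+ lit 1 :* (lit 2 :* e :* n :* s :+ (:- ((lit 1 :+ e :* e) :* n) :* lit 1)))
             refl N e (sum Δ) ⟩
      (fromℕ 3 - e * e) * N + 1ℝ * (fromℕ 2 * e * N * sum Δ + β * 1ℝ)
        ≡⟨ cong₂ (λ s t → (fromℕ 3 - e * e) * s + 1ℝ * t)
             (sym (trans (sum-const n 1ℝ) (*-identityʳ _)))
             (trans (cong (λ s → fromℕ 2 * e * N * sum Δ + β * s) (sym (total μ)))
                    (sym (sum-linear Δ (mass μ) (fromℕ 2 * e * N) β))) ⟩
      (fromℕ 3 - e * e) * sum {n} (λ _ → 1ℝ)
        + 1ℝ * sum (λ i → fromℕ 2 * e * N * Δ i + β * mass μ i)
        ≡⟨ sum-linear (λ _ → 1ℝ) (λ i → fromℕ 2 * e * N * Δ i + β * mass μ i)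
             (fromℕ 3 - e * e) 1ℝ ⟨
      sum (λ i → (fromℕ 3 - e * e) * 1ℝ + 1ℝ * (fromℕ 2 * e * N * Δ i + β * mass μ i))
        ≡⟨ sum-cong-≗ rearrange ⟩
      sum (λ i → (fromℕ 3 - e * e - fromℕ 2 * e * σ i)
                 + (fromℕ 2 * e * σ i - 1ℝ - e * e) * mass μ i * N)
        ≤⟨ sum-mono (λ i → challenge-bound μ e (σ i) (sign² (z i)) i) ⟩
      sum (λ i → fromℕ 4 * challengeProb μ i)
        ≡⟨ *-distribˡ-sum (fromℕ 4) (challengeProb μ) ⟨
      fromℕ 4 * sum (challengeProb μ)
        ≡⟨ solve 1 (λ s → lit 4 :* s := lit 2 :* (lit 2 :* s)) refl (sum (challengeProb μ)) ⟩
      fromℕ 2 * (fromℕ 2 * sum (challengeProb μ)) ∎)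
      where
      open ≤-Reasoning
      β : ℝ
      β = - ((1ℝ + e * e) * N)
      z Δ σ : Fin n → ℝ
      z i = mass μ i - mass (U n) i
      Δ i = abs (z i)
      σ i = sign (z i)

      rearrange : ∀ i →
        (fromℕ 3 - e * e) * 1ℝ + 1ℝ * (fromℕ 2 * e * N * Δ i + β * mass μ i) ≡
        (fromℕ 3 - e * e - fromℕ 2 * e * σ i) + (fromℕ 2 * e * σ i - 1ℝ - e * e) * mass μ i * N
      rearrange i = begin-equality
        (fromℕ 3 - e * e) * 1ℝ + 1ℝ * (fromℕ 2 * e * N * Δ i + β * x)
          ≡⟨ cong (λ d → (fromℕ 3 - e * e) * 1ℝ + 1ℝ * (fromℕ 2 * e * N * d + β * x))
                  (sym (sign-abs (z i))) ⟩
        (fromℕ 3 - e * e) * 1ℝ + 1ℝ * (fromℕ 2 * e * N * (σ i * (x - 1ℝ / N)) + β * x)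
          ≡⟨ solve 5 (λ e n s x u →
               (lit 3 :- e :* e) :* lit 1
                 :+ lit 1 :* (lit 2 :* e :* n :* (s :* (x :- u)) :+ :- ((lit 1 :+ e :* e) :* n) :* x)
               := lit 3 :- e :* e :+ (lit 2 :* e :* s :- lit 1 :- e :* e) :* x :* n
                 :- lit 2 :* e :* s :* (n :* u))
               refl e N (σ i) x (1ℝ / N) ⟩
        fromℕ 3 - e * e + (fromℕ 2 * e * σ i - 1ℝ - e * e) * x * N
          - fromℕ 2 * e * σ i * (N * (1ℝ / N))
          ≡⟨ cong (λ w → fromℕ 3 - e * e + (fromℕ 2 * e * σ i - 1ℝ - e * e) * x * N
                         - fromℕ 2 * e * σ i * w) N/N ⟩
        fromℕ 3 - e * e + (fromℕ 2 * e * σ i - 1ℝ - e * e) * x * N - fromℕ 2 * e * σ i * 1ℝ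
          ≡⟨ solve 4 (λ e n s x →
               lit 3 :- e :* e :+ (lit 2 :* e :* s :- lit 1 :- e :* e) :* x :* n
                 :- lit 2 :* e :* s :* lit 1
               := lit 3 :- e :* e :- lit 2 :* e :* s
                 :+ (lit 2 :* e :* s :- lit 1 :- e :* e) :* x :* n)
               refl e N (σ i) x ⟩
        (fromℕ 3 - e * e - fromℕ 2 * e * σ i) + (fromℕ 2 * e * σ i - 1ℝ - e * e) * x * N ∎
        where
        x = mass μ i

    -- The probability that the defender wins when the challenger is a k-bit
    -- number modulo n.
    voteProb : ℕ → ℝ
    voteProb k = average k λ x → challengeProb μ (x mod n)

    voteProb≤1 : ∀ k → voteProb k ≤ 1ℝ
    voteProb≤1 k = average≤1 k λ x → challengeProb≤1 μ (x mod n)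

    voteProb-nonneg : ∀ k → 0ℝ ≤ voteProb k
    voteProb-nonneg k = average-nonneg k λ x → challengeProb-nonneg μ (x mod n)

    -- Equal masses make every duel fair, so that the challenger may have any
    -- distribution.
    voteProb-uniform : Uniform n μ → ∀ k → voteProb k ≡ ½
    voteProb-uniform μ≗U k = average-const k λ x → challengeProb-½ (x mod n)
      where
      0<u = *-pos 0<1 (⁻¹-pos (fromℕ-pos n))
      winProb-½ : ∀ i j → winProb μ i j ≡ ½
      winProb-½ i j = *-cancelˡ-≡ 0<u+u (trans
        (trans (*-comm _ _) (trans (cong (winProb μ i j *_) (sym (cong₂ _+_ (μ≗U i) (μ≗U j))))
          (trans (winProb-odds μ i j) (μ≗U j))))
        (sym (trans (solve 2 (λ u h → (u :+ u) :* h := lit 2 :* h :* u) refl (1ℝ / N) ½)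
          (trans (cong (_* (1ℝ / N)) 2*½) (*-identityˡ _)))))
        where
        0<u+u : 0ℝ < 1ℝ / N + 1ℝ / N
        0<u+u = subst (0ℝ <_) (2*x _) (*-pos 0<2 0<u)
      challengeProb-½ : ∀ i → challengeProb μ i ≡ ½
      challengeProb-½ i = trans (sum-cong-≗ λ j → trans (cong (mass μ j *_) (winProb-½ i j)) (*-comm _ _))
        (trans (sym (*-distribˡ-sum ½ (mass μ))) (trans (cong (½ *_) (total μ)) (*-identityʳ ½)))

    -- The advantage e²/2 = 2 γ of a uniform challenger loses at most
    -- n / 2 ^ k ≤ γ when the challenger is a random k-bit number modulo n.
    voteProb-far : ∀ {e γ} k → 0ℝ ≤ e → 0ℝ < γ → fromℕ 4 * γ ≡ e * e → N ≤ γ * fromℕ (2 ℕ.^ k) →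
                   e ≤ distance μ (U n) → 1ℝ + fromℕ 2 * γ ≤ fromℕ 2 * voteProb k
    voteProb-far {e} {γ} k 0≤e 0<γ 4γ≡e² N≤γB e≤d = *-cancelˡ-≤ (*-pos 0<B 0<N) (≤-slack
      surplus (slack total-bound)
      (solve 4 (λ b n g q → b :* n :* (lit 1 :+ lit 2 :* g) :+
             (lit 2 :* (n :* (b :* q)) :+ lit 2 :* (n :* (g :* b))
               :- b :* (n :* (lit 1 :+ lit 4 :* g)))
             := b :* n :* (lit 2 :* q)) refl B N γ q))
      where
      open ≤-Reasoning
      B = fromℕ (2 ℕ.^ k)
      q = voteProb k
      S = sum (challengeProb μ)
      surplus = fromℕ 2 * (N * (B * q)) + fromℕ 2 * (N * (γ * B)) - B * (N * (1ℝ + fromℕ 4 * γ))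
      0<N = fromℕ-pos n
      0<B : 0ℝ < B
      0<B = fromℕ-pos (2 ℕ.^ k) {{ℕ.m^n≢0 2 k}}
      S≤N : S ≤ N
      S≤N = subst (S ≤_) (trans (sum-const n 1ℝ) (*-identityʳ _)) (sum-mono (challengeProb≤1 μ))

      total-bound : B * (N * (1ℝ + fromℕ 4 * γ)) ≤ fromℕ 2 * (N * (B * q)) + fromℕ 2 * (N * (γ * B))
      total-bound = begin
        B * (N * (1ℝ + fromℕ 4 * γ)) ≡⟨ cong (λ w → B * (N * (1ℝ + w))) 4γ≡e² ⟩
        B * (N * (1ℝ + e * e))       ≤⟨ *-monoʳ-≤ 0<B (sum-challengeProb 0≤e e≤d) ⟩
        B * (fromℕ 2 * S)            ≡⟨ solve 2 (λ b s → b :* (lit 2 :* s) := lit 2 :* (b :* s)) refl B S ⟩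
        fromℕ 2 * (B * S)
          ≤⟨ *-monoʳ-≤ 0<2 (sum-mod (challengeProb μ) (challengeProb-nonneg μ) (2 ℕ.^ k)) ⟩
        fromℕ 2 * (N * sum {2 ℕ.^ k} (λ x → challengeProb μ (toℕ x mod n)) + N * S)
          ≡⟨ cong (λ s → fromℕ 2 * (N * s + N * S)) (average-sum k λ x → challengeProb μ (x mod n)) ⟨
        fromℕ 2 * (N * (B * q) + N * S) ≡⟨ distribˡ _ _ _ ⟩
        fromℕ 2 * (N * (B * q)) + fromℕ 2 * (N * S)
          ≤⟨ +-monoʳ-≤ _ (*-monoʳ-≤ 0<2 (*-monoʳ-≤ 0<N (≤-trans S≤N N≤γB))) ⟩
        fromℕ 2 * (N * (B * q)) + fromℕ 2 * (N * (γ * B)) ∎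

  vote : ∀ {n t} .{{_ : NonZero n}} → ℕ → (Bool → Algorithm n t) → Algorithm n (suc (suc t))
  vote {n} k c = draw k λ x → query ⊤ (x mod n , Subset.∈⊤) λ j → duel (x mod n) j c

  Pr-vote : ∀ {n t} .{{_ : NonZero n}} (μ : Distribution n) k (c : Bool → Algorithm n t) v →
            Pr μ (vote k c) v ≡ mix (voteProb μ k) (Pr μ (c true) v) (Pr μ (c false) v)
  Pr-vote {n} μ k c v = Pr-draw μ k _ v {λ x → challengeProb μ (x mod n)} λ x → trans
    (sum-cong-≗ λ j → cong₂ _*_ (conditional-⊤ μ j) (Pr-duel μ (x mod n) j c v))
    (sum-mix (mass μ) (winProb μ (x mod n)) _ _ (total μ))

-- Betting on the defender

module Betting (R : RealNumbers) where
  open RealNumbers R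
  open RealProperties R
  open DistributionTesting R
  open RealSolver R
  open OrderedField R
  open Vote R

  factor : ℝ → Bool → ℝ
  factor γ true  = 1ℝ + γ
  factor γ false = 1ℝ - γ

  -- m rounds of betting with capital c. Reaching 1 at the end is evidence against
  -- uniformity: fair bets from capital δ do so with probability at most δ.
  bet : ∀ {n} .{{_ : NonZero n}} → ℕ → ℝ → ∀ m → ℝ → Algorithm n (m ℕ.* 2)
  bet k γ zero    c = output (if does (c <? 1ℝ) then accept else reject)
  bet k γ (suc m) c = vote k λ b → bet k γ m (c * factor γ b)

  module _ {n : ℕ} .{{_ : NonZero n}} (μ : Distribution n) (k : ℕ) {γ : ℝ}
           (0<γ : 0ℝ < γ) (γ<1 : γ < 1ℝ) where

    private
      0<1+γ = 0<1+x 0<γ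
      0<1-γ = 0<1-x γ<1
      0<1-γ² = 0<1-x² 0<γ γ<1

    -- A fair bet preserves the expected capital, and accepting has probability at
    -- least 1 - c when the game is over.
    bet-fair : voteProb μ k ≡ ½ → ∀ m {c} → 0ℝ ≤ c → 1ℝ - c ≤ Pr μ (bet k γ m c) accept
    bet-fair fair zero {c} 0≤c with c <? 1ℝ
    ... | yes _  = ≤-slack c 0≤c (x-y+y 1ℝ c)
    ... | no c≮1 = ≤-slack (c - 1ℝ) (slack (≮⇒≥ c≮1))
                     (solve 1 (λ c → lit 1 :- c :+ (c :- lit 1) := lit 0) refl c)
    bet-fair fair (suc m) {c} 0≤c = begin
      1ℝ - c
        ≡⟨ solve 3 (λ h c g → lit 1 :- c :=
             h :* (lit 1 :- c :* (lit 1 :+ g)) :+ (lit 1 :- h) :* (lit 1 :- c :* (lit 1 :- g))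
             :+ (lit 2 :* h :- lit 1) :* (c :* g)) refl ½ c γ ⟩
      mix ½ (1ℝ - c * (1ℝ + γ)) (1ℝ - c * (1ℝ - γ)) + (fromℕ 2 * ½ - 1ℝ) * (c * γ)
        ≡⟨ cong (λ o → mix ½ (1ℝ - c * (1ℝ + γ)) (1ℝ - c * (1ℝ - γ)) + (o - 1ℝ) * (c * γ)) 2*½ ⟩
      mix ½ (1ℝ - c * (1ℝ + γ)) (1ℝ - c * (1ℝ - γ)) + (1ℝ - 1ℝ) * (c * γ)
        ≡⟨ solve 2 (λ s t → s :+ (lit 1 :- lit 1) :* t := s) refl _ _ ⟩
      mix ½ (1ℝ - c * (1ℝ + γ)) (1ℝ - c * (1ℝ - γ))
        ≤⟨ +-mono-≤ (*-monoʳ-≤ 0<½ (bet-fair fair m (*-nonneg 0≤c (<⇒≤ 0<1+γ))))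
                    (*-monoʳ-≤-nonneg (slack ½≤1) (bet-fair fair m (*-nonneg 0≤c (<⇒≤ 0<1-γ)))) ⟩
      mix ½ (Pr μ (bet k γ m (c * (1ℝ + γ))) accept) (Pr μ (bet k γ m (c * (1ℝ - γ))) accept)
        ≡⟨ cong (λ q → mix q (Pr μ (bet k γ m (c * (1ℝ + γ))) accept)
                             (Pr μ (bet k γ m (c * (1ℝ - γ))) accept)) (sym fair) ⟩
      mix (voteProb μ k) (Pr μ (bet k γ m (c * (1ℝ + γ))) accept)
                         (Pr μ (bet k γ m (c * (1ℝ - γ))) accept)
        ≡⟨ Pr-vote μ k _ accept ⟨
      Pr μ (bet k γ (suc m) c) accept ∎
      where
      open ≤-Reasoning
      open Oracle R using (½≤1)

    -- At the end, acceptance means c < 1. One round multiplies the bound by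
    --   q (1 - γ) + (1 - q) (1 + γ) = 1 + γ - 2 q γ ≤ 1 - 2 γ² ≤ (1 - γ²)²,
    -- once both sides carry the factor 1 - γ² = (1 - γ) (1 + γ) that turns c
    -- into the two possible new capitals.
    bet-favourable : 1ℝ + fromℕ 2 * γ ≤ fromℕ 2 * voteProb μ k → ∀ m {c} → 0ℝ ≤ c →
                     c * (1ℝ - Pr μ (bet k γ m c) reject) ≤ (1ℝ - γ * γ) ^ m
    bet-favourable fav zero {c} 0≤c with c <? 1ℝ
    ... | yes c<1 = ≤-trans
            (≤-reflexive (solve 1 (λ c → c :* (lit 1 :- lit 0) := c) refl c)) (<⇒≤ c<1)
    ... | no _    = ≤-trans
            (≤-reflexive (solve 1 (λ c → c :* (lit 1 :- lit 1) := lit 0) refl c)) 0≤1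
    bet-favourable fav (suc m) {c} 0≤c = *-cancelˡ-≤ 0<1-γ² (begin
      (1ℝ - γ * γ) * (c * (1ℝ - Pr μ (bet k γ (suc m) c) reject))
        ≡⟨ cong (λ p → (1ℝ - γ * γ) * (c * (1ℝ - p))) (Pr-vote μ k _ reject) ⟩
      (1ℝ - γ * γ) * (c * (1ℝ - mix q P Q))
        ≡⟨ solve 5 (λ g c q p p′ →
             (lit 1 :- g :* g) :* (c :* (lit 1 :- (q :* p :+ (lit 1 :- q) :* p′)))
             := q :* (lit 1 :- g) :* (c :* (lit 1 :+ g) :* (lit 1 :- p))
             :+ (lit 1 :- q) :* (lit 1 :+ g) :* (c :* (lit 1 :- g) :* (lit 1 :- p′))) refl γ c q P Q ⟩
      q * (1ℝ - γ) * (c * (1ℝ + γ) * (1ℝ - P)) + (1ℝ - q) * (1ℝ + γ) * (c * (1ℝ - γ) * (1ℝ - Q))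
        ≤⟨ +-mono-≤
             (*-monoʳ-≤-nonneg (*-nonneg (voteProb-nonneg μ k) (<⇒≤ 0<1-γ))
               (bet-favourable fav m (*-nonneg 0≤c (<⇒≤ 0<1+γ))))
             (*-monoʳ-≤-nonneg (*-nonneg (slack (voteProb≤1 μ k)) (<⇒≤ 0<1+γ))
               (bet-favourable fav m (*-nonneg 0≤c (<⇒≤ 0<1-γ)))) ⟩
      q * (1ℝ - γ) * r^m + (1ℝ - q) * (1ℝ + γ) * r^m
        -- 2 q ≥ 1 + 2 γ accounts for the first part of the slack.
        ≤⟨ ≤-slack ((γ * (fromℕ 2 * q - (1ℝ + fromℕ 2 * γ)) + γ * γ * (γ * γ)) * r^m)
             (*-nonneg (+-nonneg (*-nonneg (<⇒≤ 0<γ) (slack fav)) (square-nonneg (γ * γ)))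
                       (<⇒≤ (^-pos m 0<1-γ²)))
             (solve 3 (λ g q r →
               q :* (lit 1 :- g) :* r :+ (lit 1 :- q) :* (lit 1 :+ g) :* r
               :+ (g :* (lit 2 :* q :- (lit 1 :+ lit 2 :* g)) :+ g :* g :* (g :* g)) :* r
               := (lit 1 :- g :* g) :* ((lit 1 :- g :* g) :* r)) refl γ q r^m) ⟩
      (1ℝ - γ * γ) * (1ℝ - γ * γ) ^ suc m ∎)
      where
      open ≤-Reasoning
      q = voteProb μ k
      P = Pr μ (bet k γ m (c * (1ℝ + γ))) reject
      Q = Pr μ (bet k γ m (c * (1ℝ - γ))) reject
      r^m = (1ℝ - γ * γ) ^ m

-- Choice of the parameters

module Parameters (R : RealNumbers) where
  open RealNumbers R
  open RealProperties R
  open RealSolver R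
  open OrderedField R
  open Algebra.Properties.Semiring.Exp semiring using (^-homo-*; ^-assocʳ)
  open Algebra.Properties.Semiring.Mult semiring using (×-homo-+)

  -- Descends from the witness n until the predecessor fails P. A number rounded
  -- up in this way exceeds the original by at most 1.
  roundUp : {P : ℕ → Set} → Decidable P → ∀ n → P n → ∃[ m ] P m × (∀ k → m ≡ suc k → ¬ P k)
  roundUp P? zero    p = zero , p , λ _ ()
  roundUp P? (suc n) p with P? n
  ... | yes q = roundUp P? n q
  ... | no ¬q = suc n , p , λ { _ refl → ¬q }

  infix 4 _≤?_
  _≤?_ : ∀ x y → Dec (x ≤ y)
  x ≤? y with y <? x
  ... | yes y<x = no (λ x≤y → ≤⇒≯ x≤y y<x)
  ... | no  y≮x = yes (≮⇒≥ y≮x)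

  ≰⇒≥ : ∀ {x y} → ¬ x ≤ y → y ≤ x
  ≰⇒≥ ¬p = ≮⇒≥ (¬p ∘ <⇒≤)

  -- The Bernoulli inequality (1 + k x) ≤ (1 + x) ^ k, with (1 + x) ^ k bounded by
  -- the reciprocal of (1 - x) ^ k.
  bernoulli : ∀ {x} → 0ℝ ≤ x → 0ℝ < 1ℝ - x → ∀ k → (1ℝ - x) ^ k * (1ℝ + fromℕ k * x) ≤ 1ℝ
  bernoulli {x} 0≤x 0<1-x zero    = ≤-reflexive
    (solve 1 (λ x → lit 1 :* (lit 1 :+ lit 0 :* x) := lit 1) refl x)
  bernoulli {x} 0≤x 0<1-x (suc k) = ≤-trans
    (≤-slack ((1ℝ - x) ^ k * ((1ℝ + fromℕ k) * (x * x)))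
      (*-nonneg (<⇒≤ (^-pos k 0<1-x)) (*-nonneg (fromℕ-nonneg (suc k)) (square-nonneg x)))
      (solve 3 (λ p k x → (lit 1 :- x) :* p :* (lit 1 :+ (lit 1 :+ k) :* x)
                            :+ p :* ((lit 1 :+ k) :* (x :* x))
                := p :* (lit 1 :+ k :* x)) refl ((1ℝ - x) ^ k) (fromℕ k) x))
    (bernoulli 0≤x 0<1-x k)

  half-power : ∀ {x} → 0ℝ ≤ x → x * fromℕ 2 ≤ 1ℝ → ∀ n → 0ℝ ≤ x ^ n × x ^ n * fromℕ 2 ^ n ≤ 1ℝ
  half-power     0≤x p zero    = 0≤1 , ≤-reflexive (*-identityˡ 1ℝ)
  half-power {x} 0≤x p (suc n) with half-power 0≤x p n
  ... | 0≤xⁿ , q = *-nonneg 0≤x 0≤xⁿ , subst₂ _≤_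
          (solve 4 (λ x t p s → x :* t :* (p :* s) := x :* p :* (t :* s))
             refl x (fromℕ 2) (x ^ n) (fromℕ 2 ^ n))
          (*-identityˡ 1ℝ)
          (*-mono-≤ (*-nonneg 0≤x (<⇒≤ 0<2)) (*-nonneg 0≤xⁿ (<⇒≤ (^-pos n 0<2))) p q)

  module _ (ε : ℝ) where
    private
      N = proj₁ (archimedean (ε ⁻¹))
      rounded = roundUp (λ d → ε ⁻¹ ≤? fromℕ (suc d)) N
        (≤-trans (<⇒≤ (proj₂ (archimedean (ε ⁻¹)))) (fromℕ-mono-≤ (ℕ.n≤1+n N)))

    -- 1/ε rounded up, and positive even if ε ⁻¹ is not.
    resolution : ℕ
    resolution = suc (proj₁ rounded)

    ε⁻¹≤resolution : ε ⁻¹ ≤ fromℕ resolution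
    ε⁻¹≤resolution = proj₁ (proj₂ rounded)

    resolution≤ : 0ℝ ≤ ε ⁻¹ → fromℕ resolution ≤ 1ℝ + ε ⁻¹
    resolution≤ 0≤X = go (proj₁ rounded) (proj₂ (proj₂ rounded))
      where
      go : ∀ d → (∀ k → d ≡ suc k → ¬ ε ⁻¹ ≤ fromℕ (suc k)) → fromℕ (suc d) ≤ 1ℝ + ε ⁻¹
      go zero    _ = +-monoʳ-≤ 1ℝ 0≤X
      go (suc d) h = +-monoʳ-≤ 1ℝ (≰⇒≥ (h d refl))

  module _ (δ : ℝ) where
    private
      N = proj₁ (archimedean (δ ⁻¹))
      rounded = roundUp (λ l → δ ⁻¹ ≤? fromℕ 2 ^ l) N
        (≤-trans (<⇒≤ (proj₂ (archimedean (δ ⁻¹)))) (n≤2^n N))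

    -- The logarithm of 1/δ to base 2, rounded up to a natural number.
    confidence : ℕ
    confidence = proj₁ rounded

    δ⁻¹≤2^confidence : δ ⁻¹ ≤ fromℕ 2 ^ confidence
    δ⁻¹≤2^confidence = proj₁ (proj₂ rounded)

    -- If 2 ^ l < 1/δ then l belongs to the cut that defines the logarithm.
    confidence≤ : 1ℝ < δ ⁻¹ → (0<δ⁻¹ : 0ℝ < δ ⁻¹) → fromℕ confidence ≤ 1ℝ + log₂ (δ ⁻¹) 0<δ⁻¹
    confidence≤ 1<δ⁻¹ 0<δ⁻¹ = go confidence δ⁻¹≤2^confidence (proj₂ (proj₂ rounded))
      where
      go : ∀ l → δ ⁻¹ ≤ fromℕ 2 ^ l → (∀ k → l ≡ suc k → ¬ δ ⁻¹ ≤ fromℕ 2 ^ k) →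
           fromℕ l ≤ 1ℝ + log₂ (δ ⁻¹) 0<δ⁻¹
      go zero    p _ = contradiction 1<δ⁻¹ (≤⇒≯ p)
      go (suc l) _ h = +-monoʳ-≤ 1ℝ (subst (_≤ log₂ (δ ⁻¹) 0<δ⁻¹) quotient
          (IsSupremum.upper (proj₂ (log₂-sup (δ ⁻¹) 0<δ⁻¹)) (l , 0 , 1 , _ , refl ,
            subst (fromℕ 2 ^ l ≤_) (solve 1 (λ x → x := lit 1 :* (x :* lit 1)) refl (δ ⁻¹))
              (≰⇒≥ (h l refl)))))
        where
        quotient : (fromℕ l - fromℕ 0) / fromℕ 1 ≡ fromℕ l
        quotient = trans
          (solve 2 (λ x y → (x :- lit 0) :* y := x :* ((lit 1 :+ lit 0) :* y))
             refl (fromℕ l) (fromℕ 1 ⁻¹))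
          (trans (cong (fromℕ l *_) (*-inverseʳ (0<⇒≢0 (fromℕ-pos 1)))) (*-identityʳ _))

  module _ (D : ℕ) .{{_ : NonZero D}} where

    -- With e = 1/D, the reciprocal of the stake γ = e²/4. Being natural, it also
    -- serves to count coin tosses and rounds.
    scale : ℕ
    scale = 4 ℕ.* (D ℕ.* D)

    private
      instance
        D*D≢0 : NonZero (D ℕ.* D)
        D*D≢0 = ℕ.m*n≢0 D D
        scale≢0 : NonZero scale
        scale≢0 = ℕ.m*n≢0 4 (D ℕ.* D)

      e γ : ℝ
      e = fromℕ D ⁻¹
      γ = fromℕ scale ⁻¹

    0<gap : 0ℝ < γ
    0<gap = ⁻¹-pos (fromℕ-pos scale)

    scale*gap : fromℕ scale * γ ≡ 1ℝ
    scale*gap = *-inverseʳ (0<⇒≢0 (fromℕ-pos scale))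

    fromℕ-scale : fromℕ scale ≡ fromℕ 4 * (fromℕ D * fromℕ D)
    fromℕ-scale = trans (fromℕ-* 4 (D ℕ.* D)) (cong (fromℕ 4 *_) (fromℕ-* D D))

    4*gap : fromℕ 4 * γ ≡ e * e
    4*gap = *-cancelˡ-≡ (*-pos (fromℕ-pos D) (fromℕ-pos D)) (begin
      d * d * (fromℕ 4 * γ)     ≡⟨ solve 2 (λ d g → d :* d :* (lit 4 :* g) :=
                                                    lit 4 :* (d :* d) :* g) refl d γ ⟩
      fromℕ 4 * (d * d) * γ     ≡⟨ cong (_* γ) fromℕ-scale ⟨
      fromℕ scale * γ           ≡⟨ scale*gap ⟩
      1ℝ                        ≡⟨ *-identityˡ 1ℝ ⟨
      1ℝ * 1ℝ                   ≡⟨ cong₂ _*_ d*e d*e ⟨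
      d * e * (d * e)           ≡⟨ solve 2 (λ d e → d :* e :* (d :* e) :=
                                                    d :* d :* (e :* e)) refl d e ⟩
      d * d * (e * e)           ∎)
      where
      open ≡-Reasoning
      d = fromℕ D
      d*e : d * e ≡ 1ℝ
      d*e = *-inverseʳ (0<⇒≢0 (fromℕ-pos D))

    gap<1 : γ < 1ℝ
    gap<1 = <-≤-trans
      (subst₂ _<_ (+-identityʳ γ) (solve 1 (λ g → g :+ lit 3 :* g := lit 4 :* g) refl γ)
        (+-monoʳ-< γ (*-pos (fromℕ-pos 3) 0<gap)))
      (subst (fromℕ 4 * γ ≤_) scale*gap
        (*-monoˡ-≤ 0<gap (fromℕ-mono-≤ (ℕ.m≤m*n 4 (D ℕ.* D)))))

    n≤gap*2^ : ∀ n → fromℕ n ≤ γ * fromℕ (2 ℕ.^ (scale ℕ.* n))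
    n≤gap*2^ n = subst (_≤ γ * fromℕ (2 ℕ.^ (scale ℕ.* n)))
      (trans (cong (γ *_) (fromℕ-* scale n))
        (trans (solve 3 (λ g s n → g :* (s :* n) := s :* g :* n) refl γ (fromℕ scale) (fromℕ n))
          (trans (cong (_* fromℕ n) scale*gap) (*-identityˡ _))))
      (*-monoʳ-≤ 0<gap
        (subst (fromℕ (scale ℕ.* n) ≤_) (sym (fromℕ-2^ (scale ℕ.* n))) (n≤2^n (scale ℕ.* n))))

    private
      0<1-gap² = 0<1-x² 0<gap gap<1

    -- (1 - γ²) ^ (1/γ²) ≤ 1/2 by Bernoulli, and 1/2 ^ L ≤ δ.
    decay : ∀ {δ L} → 0ℝ < δ → δ ⁻¹ ≤ fromℕ 2 ^ L →
            (1ℝ - γ * γ) ^ (scale ℕ.* scale ℕ.* (L ℕ.+ L)) ≤ δ * δ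
    decay {δ} {L} 0<δ δ⁻¹≤2^L = subst (_≤ δ * δ)
      (trans (sym (^-homo-* ρ L L)) (^-assocʳ (1ℝ - γ * γ) N (L ℕ.+ L)))
      (*-mono-≤ 0≤ρᴸ 0≤ρᴸ ρᴸ≤δ ρᴸ≤δ)
      where
      N = scale ℕ.* scale
      ρ = (1ℝ - γ * γ) ^ N
      N*γ² : fromℕ N * (γ * γ) ≡ 1ℝ
      N*γ² = trans (cong (_* (γ * γ)) (fromℕ-* scale scale))
        (trans (solve 2 (λ s g → s :* s :* (g :* g) := s :* g :* (s :* g)) refl (fromℕ scale) γ)
          (trans (cong₂ _*_ scale*gap scale*gap) (*-identityˡ 1ℝ)))
      ρ*2≤1 : ρ * fromℕ 2 ≤ 1ℝ
      ρ*2≤1 = subst (λ x → ρ * x ≤ 1ℝ)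
        (trans (cong (1ℝ +_) N*γ²) (cong (1ℝ +_) (sym (+-identityʳ 1ℝ))))
        (bernoulli (square-nonneg γ) 0<1-gap² N)
      powers = half-power (<⇒≤ (^-pos N 0<1-gap²)) ρ*2≤1 L
      0≤ρᴸ : 0ℝ ≤ ρ ^ L
      0≤ρᴸ = proj₁ powers
      ρᴸ≤δ : ρ ^ L ≤ δ
      ρᴸ≤δ = begin
        ρ ^ L                         ≡⟨ *-identityʳ _ ⟨
        ρ ^ L * 1ℝ                    ≡⟨ cong (ρ ^ L *_) (*-inverseʳ (0<⇒≢0 0<δ)) ⟨
        ρ ^ L * (δ * δ ⁻¹)            ≤⟨ *-monoʳ-≤-nonneg 0≤ρᴸ (*-monoʳ-≤ 0<δ δ⁻¹≤2^L) ⟩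
        ρ ^ L * (δ * fromℕ 2 ^ L)     ≡⟨ solve 3 (λ p d t → p :* (d :* t) := d :* (p :* t))
                                           refl (ρ ^ L) δ (fromℕ 2 ^ L) ⟩
        δ * (ρ ^ L * fromℕ 2 ^ L)     ≤⟨ *-monoʳ-≤ 0<δ (proj₂ powers) ⟩
        δ * 1ℝ                        ≡⟨ *-identityʳ δ ⟩
        δ                             ∎
        where open ≤-Reasoning

-- The tester and its sample complexity

module Tester (R : RealNumbers) where
  open RealNumbers R
  open RealProperties R
  open DistributionTesting R
  open RealSolver R
  open OrderedField R
  open Vote R
  open Betting R
  open Parameters R
  open Algebra.Properties.Semiring.Mult semiring using (×-homo-+)

  -- 2 L / γ², where L is at least the binary logarithm of 1/δ.
  rounds : ℝ → ℝ → ℕ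
  rounds ε δ = scale (resolution ε) ℕ.* scale (resolution ε) ℕ.* (confidence δ ℕ.+ confidence δ)

  -- The advantage of the defender that the tester counts on, and its stake.
  gap : ℝ → ℝ
  gap ε = fromℕ (scale (resolution ε)) ⁻¹

  uniformityTester : ∀ ε δ n .{{_ : NonZero n}} → Algorithm n (rounds ε δ ℕ.* 2)
  uniformityTester ε δ n = bet (scale (resolution ε) ℕ.* n) (gap ε) (rounds ε δ) δ

  module _ {ε δ : ℝ} (0<ε : 0ℝ < ε) (0<δ : 0ℝ < δ)
           (n : ℕ) .{{_ : NonZero n}} (μ : Distribution n) where
    private
      D = resolution ε
      k = scale D ℕ.* n

    accepts-uniform : Uniform n μ → 1ℝ - δ ≤ Pr μ (uniformityTester ε δ n) accept
    accepts-uniform μ≗U =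
      bet-fair μ k (0<gap D) (gap<1 D) (voteProb-uniform μ μ≗U k) (rounds ε δ) (<⇒≤ 0<δ)

    1/D≤ε : fromℕ D ⁻¹ ≤ ε
    1/D≤ε = *-cancelˡ-≤ (fromℕ-pos D) (subst (_≤ fromℕ D * ε)
      (trans (trans (*-comm _ _) (*-inverseʳ (0<⇒≢0 0<ε)))
             (sym (*-inverseʳ (0<⇒≢0 (fromℕ-pos D)))))
      (*-monoˡ-≤ 0<ε (ε⁻¹≤resolution ε)))

    rejects-far : Far Uniform ε n μ → 1ℝ - δ ≤ Pr μ (uniformityTester ε δ n) reject
    rejects-far far = ≤-slack (δ - (1ℝ - r)) (slack 1-r≤δ)
      (solve 2 (λ d r → lit 1 :- d :+ (d :- (lit 1 :- r)) := r) refl δ r)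
      where
      r = Pr μ (uniformityTester ε δ n) reject
      1/D≤distance : fromℕ D ⁻¹ ≤ distance μ (U n)
      1/D≤distance = ≤-trans 1/D≤ε (far (U n) (λ _ → refl))
      1-r≤δ : 1ℝ - r ≤ δ
      1-r≤δ = *-cancelˡ-≤ 0<δ (≤-trans
        (bet-favourable μ k (0<gap D) (gap<1 D)
          (voteProb-far μ k (<⇒≤ (⁻¹-pos (fromℕ-pos D))) (0<gap D) (4*gap D) (n≤gap*2^ D n)
            1/D≤distance)
          (rounds ε δ) (<⇒≤ 0<δ))
        (decay D {L = confidence δ} 0<δ (δ⁻¹≤2^confidence δ)))

  tester : AdaptiveTester Uniform
  tester = record
    { complexity = λ ε δ _ → rounds ε δ ℕ.* 2
    ; algorithm  = uniformityTester
    ; accepts    = accepts-uniform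
    ; rejects    = rejects-far
    }

  -- 64 (2 X)⁴ (1 + Y), where 2 X bounds the resolution and 1 + Y the confidence.
  bound : Polynomial₂
  bound = (fromℕ 1024 , 4 , 1) ∷ (fromℕ 1024 , 4 , 0) ∷ []

  1<⁻¹ : ∀ {x} → 0ℝ < x → x < 1ℝ → 1ℝ < x ⁻¹
  1<⁻¹ {x} 0<x x<1 = subst₂ _<_ (*-inverseʳ (0<⇒≢0 0<x)) (*-identityˡ (x ⁻¹))
    (*-monoˡ-< (⁻¹-pos 0<x) x<1)

  samples : ∀ D .{{_ : NonZero D}} L → fromℕ (scale D ℕ.* scale D ℕ.* (L ℕ.+ L) ℕ.* 2) ≡
            fromℕ 64 * (fromℕ D * fromℕ D * (fromℕ D * fromℕ D) * fromℕ L)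
  samples D L = begin
    fromℕ (M ℕ.* M ℕ.* (L ℕ.+ L) ℕ.* 2)
      ≡⟨ fromℕ-* (M ℕ.* M ℕ.* (L ℕ.+ L)) 2 ⟩
    fromℕ (M ℕ.* M ℕ.* (L ℕ.+ L)) * fromℕ 2
      ≡⟨ cong (_* fromℕ 2) (fromℕ-* (M ℕ.* M) (L ℕ.+ L)) ⟩
    fromℕ (M ℕ.* M) * fromℕ (L ℕ.+ L) * fromℕ 2
      ≡⟨ cong₂ (λ m l → m * l * fromℕ 2) (fromℕ-* M M) (×-homo-+ 1ℝ L L) ⟩
    fromℕ M * fromℕ M * (fromℕ L + fromℕ L) * fromℕ 2
      ≡⟨ cong (λ m → m * m * (fromℕ L + fromℕ L) * fromℕ 2) (fromℕ-scale D) ⟩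
    fromℕ 4 * (fromℕ D * fromℕ D) * (fromℕ 4 * (fromℕ D * fromℕ D))
      * (fromℕ L + fromℕ L) * fromℕ 2
      ≡⟨ solve 2 (λ d l → lit 4 :* (d :* d) :* (lit 4 :* (d :* d)) :* (l :+ l) :* lit 2 :=
                          lit 64 :* (d :* d :* (d :* d) :* l)) refl (fromℕ D) (fromℕ L) ⟩
    fromℕ 64 * (fromℕ D * fromℕ D * (fromℕ D * fromℕ D) * fromℕ L) ∎
    where
    open ≡-Reasoning
    M = scale D

  complexity-bound : ∀ ε δ → 0ℝ < ε → ε < 1ℝ → (0<δ : 0ℝ < δ) → δ < 1ℝ →
    fromℕ (rounds ε δ ℕ.* 2) ≤ eval bound (ε ⁻¹) (log₂ (δ ⁻¹) (⁻¹-pos 0<δ))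
  complexity-bound ε δ 0<ε ε<1 0<δ δ<1 = begin
    fromℕ (rounds ε δ ℕ.* 2)
      ≡⟨ samples D L ⟩
    fromℕ 64 * (fromℕ D * fromℕ D * (fromℕ D * fromℕ D) * fromℕ L)
      ≤⟨ *-monoʳ-≤ (fromℕ-pos 64) (*-mono-≤ 0≤D⁴ (fromℕ-nonneg L)
           (*-mono-≤ 0≤D² 0≤D² D²≤ D²≤) (confidence≤ δ (1<⁻¹ 0<δ δ<1) (⁻¹-pos 0<δ))) ⟩
    fromℕ 64 * (fromℕ 2 * X * (fromℕ 2 * X) * (fromℕ 2 * X * (fromℕ 2 * X)) * (1ℝ + Y))
      ≡⟨ solve 2 (λ x y →
           lit 64 :* (lit 2 :* x :* (lit 2 :* x) :* (lit 2 :* x :* (lit 2 :* x)) :* (lit 1 :+ y)) :=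
           lit 1024 :* (x :* (x :* (x :* (x :* lit 1)))) :* (y :* lit 1) :+
           (lit 1024 :* (x :* (x :* (x :* (x :* lit 1)))) :* lit 1 :+ lit 0)) refl X Y ⟩
    eval bound X Y ∎
    where
    open ≤-Reasoning
    D = resolution ε
    L = confidence δ
    X = ε ⁻¹
    Y = log₂ (δ ⁻¹) (⁻¹-pos 0<δ)
    D≤2X : fromℕ D ≤ fromℕ 2 * X
    D≤2X = ≤-trans (resolution≤ ε (<⇒≤ (⁻¹-pos 0<ε)))
      (subst (1ℝ + X ≤_) (sym (2*x X)) (+-monoˡ-≤ X (<⇒≤ (1<⁻¹ 0<ε ε<1))))
    D²≤ = *-mono-≤ (fromℕ-nonneg D) (fromℕ-nonneg D) D≤2X D≤2X
    0≤D² = square-nonneg (fromℕ D)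
    0≤D⁴ = square-nonneg (fromℕ D * fromℕ D)

theorem3p1p1 :
    (R : RealNumbers) →
    let open RealNumbers R
        open RealProperties R
        open DistributionTesting R
        open AdaptiveTester
    in Σ[ T ∈ AdaptiveTester Uniform ] Σ[ p ∈ Polynomial₂ ]
         (∀ (ε δ : ℝ) → 0ℝ < ε → ε < 1ℝ → (0<δ : 0ℝ < δ) → δ < 1ℝ →
          ∀ (n : ℕ) .{{_ : NonZero n}} →
          fromℕ (complexity T ε δ n) ≤ eval p (ε ⁻¹) (log₂ (δ ⁻¹) (⁻¹-pos 0<δ)))
theorem3p1p1 R = Tester.tester R , Tester.bound R ,
  λ ε δ 0<ε ε<1 0<δ δ<1 n → Tester.complexity-bound R ε δ 0<ε ε<1 0<δ δ<1
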